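{- For all integers $k\ge 1$, $n\ge 0$ and all $$(a,b,c)\in\{(1,3,4),(1,3,5),(1,4,5),(1,5,7)\},$$ we have $\gamma_{a,b,c,2,1}^k(n)\ge 0$; that is, the coefficient of $q^n$ in $$\frac{1}{(1-q^a)(1-q^b)(1-q^c)}\sum_{j\notin[-k,k-1]}(-1)^{j+k}q^{2j^2+j}$$ is nonnegative.
   Context: Identities are between formal power series in $q$. The sum $\sum_{j\notin[-k,k-1]}$ is over all integers $j\le -k-1$ and all integers $j\ge k$. In general $\gamma_{a,b,c,A,B}^k(n)$ is defined by $\frac{1}{(1-q^a)(1-q^b)(1-q^c)}\sum_{j\notin[-k,k-1]}(-1)^{j+k}q^{Aj^2+Bj}=\sum_{n\ge0}\gamma_{a,b,c,A,B}^k(n)q^n$. -}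

module Defs where

open import Data.Bool.Base using (if_then_else_)
open import Data.Fin.Base using (Fin; zero; suc; toℕ)
open import Data.Integer.Base
  using (ℤ; +_; -[1+_]; 0ℤ; 1ℤ; -1ℤ; _+_; _-_; -_; _*_; _^_; ∣_∣)
import Data.Integer.Properties as ℤ
import Data.Integer.Tactic.RingSolver as ℤ-Solver
open import Data.Nat.Base as ℕ using (ℕ; zero; suc; z≤n; s≤s; _≤_; _<_; _∸_)
import Data.Nat.Properties as ℕ
import Data.Nat.Tactic.RingSolver as ℕ-Solver
open import Data.Vec.Base using (Vec; []; _∷_; head; lookup)
open import Relation.Binary.PropositionalEquality
  using (_≡_; _≢_; refl; sym; trans; cong; cong₂; module ≡-Reasoning)
open import Relation.Nullary.Decidable using (does; dec-false)

open import Algebra.Properties.CommutativeMonoid.Sum ℤ.+-0-commutativeMonoid public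
  using (sum-syntax; sum⁺-syntax; sum-cong-≗; sum-replicate-zero)

-- The series f stands for Σₙ f(n) qⁿ; equality of series is pointwise.
PowerSeries : Set
PowerSeries = ℕ → ℤ

-- Exponents are integers because A j² + B j is computed in ℤ.  A negative
-- exponent would give the zero series; none occurs in γ when B ≤ A.
infix 9 q^_
q^_ : ℤ → PowerSeries
(q^ e) n = if does (e ℤ.≟ + n) then 1ℤ else 0ℤ

𝟙 : PowerSeries
𝟙 = q^ 0ℤ

infixl 7 _⊛_
_⊛_ : PowerSeries → PowerSeries → PowerSeries
(f ⊛ g) n = ∑[ i ≤ n ] (f (toℕ i) * g (n ∸ toℕ i))

-- initial f n lists the coefficients n−1, …, 1, 0 (in this order) of 1/f, as
-- determined by  Σ_{i≤n} f(i) g(n−i) = 𝟙(n)  when f(0) = 1.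
initial : PowerSeries → (n : ℕ) → Vec ℤ n
initial f zero    = []
initial f (suc n) =
  (𝟙 n - ∑[ i < n ] (f (suc (toℕ i)) * lookup (initial f n) i)) ∷ initial f n

-- The multiplicative inverse of a series with constant term 1 (see ⊛-inverse);
-- meaningless for other series.
infix 8 1/_
1/_ : PowerSeries → PowerSeries
(1/ f) n = head (initial f (suc n))

1−q^_ : ℕ → PowerSeries
(1−q^ a) n = 𝟙 n - (q^ (+ a)) n

denominator : ℕ → ℕ → ℕ → PowerSeries
denominator a b c = (1−q^ a) ⊛ (1−q^ b) ⊛ (1−q^ c)

summand : (A B k : ℕ) → ℤ → PowerSeries
summand A B k j n = -1ℤ ^ ∣ j + + k ∣ * (q^ (+ A * (j * j) + + B * j)) n

-- The integers j ∉ [−k, k−1] are j = k + i and j = −k−1−i for i ≥ 0; this is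
-- the sum over those with i < N.
partialSum : (A B k N : ℕ) → PowerSeries
partialSum A B k N n =
  ∑[ i < N ] ( summand A B k (+ (k ℕ.+ toℕ i)) n
             + summand A B k -[1+ k ℕ.+ toℕ i ] n )

-- The infinite sum over j ∉ [−k, k−1].  If 1 ≤ A and B ≤ A, the coefficient of
-- qⁿ in the partial sums is constant from N = n + 1 on (see partialSum-stable).
tailSum : (A B k : ℕ) → PowerSeries
tailSum A B k n = partialSum A B k (suc n) n

γ : (a b c A B k : ℕ) → PowerSeries
γ a b c A B k = 1/ denominator a b c ⊛ tailSum A B k

lookup-initial : ∀ f n (i : Fin n) → lookup (initial f n) i ≡ (1/ f) (n ∸ suc (toℕ i))
lookup-initial f (suc n) zero    = refl
lookup-initial f (suc n) (suc i) = lookup-initial f n i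

⊛-inverse : ∀ f → f 0 ≡ 1ℤ → ∀ n → (f ⊛ 1/ f) n ≡ 𝟙 n
⊛-inverse f f₀≡1 n = begin
  f 0 * (1/ f) n + ∑[ i < n ] (f (suc (toℕ i)) * (1/ f) (n ∸ suc (toℕ i)))
    ≡⟨ cong₂ _+_ (trans (cong (_* (1/ f) n) f₀≡1) (ℤ.*-identityˡ ((1/ f) n)))
         (sum-cong-≗ {n} λ i → cong (f (suc (toℕ i)) *_) (sym (lookup-initial f n i))) ⟩
  (𝟙 n - s) + s
    ≡⟨ cancel (𝟙 n) s ⟩
  𝟙 n ∎
  where
  open ≡-Reasoning
  s = ∑[ i < n ] (f (suc (toℕ i)) * lookup (initial f n) i)
  cancel : ∀ x y → (x - y) + y ≡ x
  cancel = ℤ-Solver.solve-∀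

denominator-inverse : ∀ a b c → 1 ≤ a → 1 ≤ b → 1 ≤ c →
  ∀ n → (denominator a b c ⊛ 1/ denominator a b c) n ≡ 𝟙 n
denominator-inverse (suc a) (suc b) (suc c) _ _ _ =
  ⊛-inverse (denominator (suc a) (suc b) (suc c)) refl

sum-stable : ∀ (h : ℕ → ℤ) N → (∀ m → N ≤ m → h m ≡ 0ℤ) →
  ∀ M → N ≤ M → ∑[ i < M ] h (toℕ i) ≡ ∑[ i < N ] h (toℕ i)
sum-stable h zero    h≡0 M       _         =
  trans (sum-cong-≗ {M} λ i → h≡0 (toℕ i) z≤n) (sum-replicate-zero M)
sum-stable h (suc N) h≡0 (suc M) (s≤s N≤M) =
  cong (λ s → h 0 + s) (sum-stable (λ m → h (suc m)) N (λ m N≤m → h≡0 (suc m) (s≤s N≤m)) M N≤M)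

summand-zero : ∀ A B k j n → + A * (j * j) + + B * j ≢ + n → summand A B k j n ≡ 0ℤ
summand-zero A B k j n e≢n
  rewrite dec-false (+ A * (j * j) + + B * j ℤ.≟ + n) e≢n =
  ℤ.*-zeroʳ (-1ℤ ^ ∣ j + + k ∣)

exponent⁺ : ∀ A B m n → 1 ≤ A → n < m → + A * (+ m * + m) + + B * + m ≢ + n
exponent⁺ A B m@(suc _) n 1≤A n<m eq = ℕ.<-irrefl (sym (ℤ.+-injective eq′)) n<e
  where
  eq′ : + (A ℕ.* (m ℕ.* m) ℕ.+ B ℕ.* m) ≡ + n
  eq′ = trans (cong₂ _+_ (ℤ.pos-* A (m ℕ.* m)) (ℤ.pos-* B m)) eq
  n<e : n < A ℕ.* (m ℕ.* m) ℕ.+ B ℕ.* m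
  n<e = begin-strict
    n                               <⟨ n<m ⟩
    m                               ≤⟨ ℕ.m≤m*n m m ⟩
    m ℕ.* m                         ≡⟨ ℕ.*-identityˡ (m ℕ.* m) ⟨
    1 ℕ.* (m ℕ.* m)                 ≤⟨ ℕ.*-monoˡ-≤ (m ℕ.* m) 1≤A ⟩
    A ℕ.* (m ℕ.* m)                 ≤⟨ ℕ.m≤m+n _ _ ⟩
    A ℕ.* (m ℕ.* m) ℕ.+ B ℕ.* m     ∎
    where open ℕ.≤-Reasoning

exponent⁻ : ∀ A B p n → 1 ≤ A → B ≤ A → n < p →
  + A * (-[1+ p ] * -[1+ p ]) + + B * -[1+ p ] ≢ + n
exponent⁻ A B p n 1≤A B≤A n<p eq = ℕ.<-irrefl (sym (ℤ.+-injective eq′)) n+Bm<e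
  where
  m = suc p
  move : ∀ x b y → (x + b * (- y)) + b * y ≡ x
  move = ℤ-Solver.solve-∀
  eq′ : + (A ℕ.* (m ℕ.* m)) ≡ + (n ℕ.+ B ℕ.* m)
  eq′ = begin
    + (A ℕ.* (m ℕ.* m))                            ≡⟨ ℤ.pos-* A (m ℕ.* m) ⟩
    + A * + (m ℕ.* m)                              ≡⟨ move (+ A * + (m ℕ.* m)) (+ B) (+ m) ⟨
    (+ A * + (m ℕ.* m) + + B * -[1+ p ]) + + B * + m ≡⟨ cong (λ x → x + + B * + m) eq ⟩
    + n + + B * + m                                ≡⟨ cong (λ x → + n + x) (ℤ.pos-* B m) ⟨
    + (n ℕ.+ B ℕ.* m)                              ∎
    where open ≡-Reasoning
  split : ∀ x y → y ℕ.* x ℕ.+ x ℕ.* (1 ℕ.+ y) ≡ x ℕ.* (1 ℕ.+ y ℕ.+ y)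
  split = ℕ-Solver.solve-∀
  n+Bm<e : n ℕ.+ B ℕ.* m < A ℕ.* (m ℕ.* m)
  n+Bm<e = begin-strict
    n ℕ.+ B ℕ.* m             <⟨ ℕ.+-monoˡ-< (B ℕ.* m) n<p ⟩
    p ℕ.+ B ℕ.* m             ≤⟨ ℕ.+-monoʳ-≤ p (ℕ.*-monoˡ-≤ m B≤A) ⟩
    p ℕ.+ A ℕ.* m             ≡⟨ cong (ℕ._+ A ℕ.* m) (ℕ.*-identityʳ p) ⟨
    p ℕ.* 1 ℕ.+ A ℕ.* m       ≤⟨ ℕ.+-monoˡ-≤ (A ℕ.* m) (ℕ.*-monoʳ-≤ p 1≤A) ⟩
    p ℕ.* A ℕ.+ A ℕ.* m       ≡⟨ split A p ⟩
    A ℕ.* (m ℕ.+ p)           ≤⟨ ℕ.*-monoʳ-≤ A (ℕ.+-monoʳ-≤ m (ℕ.m≤m*n p m)) ⟩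
    A ℕ.* (m ℕ.+ p ℕ.* m)     ∎
    where open ℕ.≤-Reasoning

partialSum-stable : ∀ A B k n N → 1 ≤ A → B ≤ A → n < N →
  partialSum A B k N n ≡ tailSum A B k n
partialSum-stable A B k n N 1≤A B≤A n<N =
  sum-stable
    (λ i → summand A B k (+ (k ℕ.+ i)) n + summand A B k -[1+ k ℕ.+ i ] n)
    (suc n) vanish N n<N
  where
  vanish : ∀ i → n < i →
    summand A B k (+ (k ℕ.+ i)) n + summand A B k -[1+ k ℕ.+ i ] n ≡ 0ℤ
  vanish i n<i = cong₂ _+_
    (summand-zero A B k (+ (k ℕ.+ i)) n (exponent⁺ A B (k ℕ.+ i) n 1≤A n<k+i))
    (summand-zero A B k -[1+ k ℕ.+ i ] n (exponent⁻ A B (k ℕ.+ i) n 1≤A B≤A n<k+i))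
    where
    n<k+i : n < k ℕ.+ i
    n<k+i = ℕ.<-≤-trans n<i (ℕ.m≤n+m i k)

{-# OPTIONS --safe #-}

-- The exponents 2 j² + j are the triangular numbers T₂ₘ (j = m) and T₂ₘ₊₁
-- (j = − m − 1).  Let p be the coefficients of 1 / ((1 − q) (1 − qᵇ) (1 − qᶜ)).
-- Then γ(n) = d(k) − d(k + 1) + d(k + 2) − … with d(m) = p(n − T₂ₘ) − p(n − T₂ₘ₊₁),
-- and 8 b c p(x) = (2 x + 1 + b + c)² + (a function of x mod b c).  With
-- X = 2 n + 1 + b + c, the squares contribute G(m) + G(m + 1) to 8 b c d(m) for the
-- cubic G(m) = 4 m (X + 3 − 4 m²), so the alternating sum telescopes to G(k) up to
-- an error from the last term, at most 12 M (M + 1) where T₂ₘ ≤ n < T₂ₘ₊₂ for m = M,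
-- and a bounded error for each gap.  As X ≥ 4 M², G(k) ≥ G(1) ≈ 16 M² wins for
-- large M, and G(k) ≥ G(2) ≈ 32 M² wins earlier when k ≥ 2.  The remaining M are
-- checked by evaluation; the case k = M is the monotonicity of p.
module Submission where

open import Data.Bool.Base using (true; false; if_then_else_)
open import Data.Fin.Base using (toℕ)
open import Data.Integer.Base
  using (ℤ; +_; -[1+_]; 0ℤ; 1ℤ; -1ℤ; _+_; _-_; -_; _*_; _^_; ∣_∣; _⊖_; _≤_; +≤+; +<+; Positive; positive)
import Data.Integer.Properties as ℤ
import Data.Integer.Tactic.RingSolver as ℤ-Solver
open import Data.List.Base using (List; []; _∷_; applyUpTo)
open import Data.List.Membership.Propositional using (_∈_)
open import Data.List.Relation.Unary.Any using (here; there)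
open import Data.Nat.Base as ℕ using (ℕ; zero; suc; z≤n; s≤s; _<ᵇ_; _∸_; NonZero)
import Data.Nat.DivMod as ℕ
import Data.Nat.Properties as ℕ
import Data.Nat.Tactic.RingSolver as ℕ-Solver
open import Data.Product.Base using (_×_; _,_; ∃₂)
open import Data.Sum.Base using (inj₁; inj₂)
open import Function.Base using (_∘_)
open import Relation.Binary.PropositionalEquality
  using (_≡_; _≗_; refl; sym; trans; cong; cong₂; subst; subst₂; module ≡-Reasoning)
open import Relation.Nullary.Decidable using (Dec; from-yes; _×-dec_; map′)

open import Defs

-- The ring of power series

-- Agreement is asked for only up to `n` because a single partial sum matches `tailSum` only on an
-- initial range of coefficients.
⊛-congˡ : ∀ {f f′} g n → (∀ i → i ℕ.≤ n → f i ≡ f′ i) → (f ⊛ g) n ≡ (f′ ⊛ g) n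
⊛-congˡ g zero    f≡f′ = cong (λ x → x * g 0 + 0ℤ) (f≡f′ 0 z≤n)
⊛-congˡ g (suc n) f≡f′ = cong₂ (λ x y → x * g (suc n) + y) (f≡f′ 0 z≤n)
  (⊛-congˡ g n λ i i≤n → f≡f′ (suc i) (s≤s i≤n))

⊛-congʳ : ∀ f {g g′} → g ≗ g′ → f ⊛ g ≗ f ⊛ g′
⊛-congʳ f g≗g′ zero    = cong (λ y → f 0 * y + 0ℤ) (g≗g′ 0)
⊛-congʳ f g≗g′ (suc n) = cong₂ (λ x y → f 0 * x + y) (g≗g′ (suc n)) (⊛-congʳ (f ∘ suc) g≗g′ n)

⊛-distribʳ-+ : ∀ f g h n → ((λ i → f i + g i) ⊛ h) n ≡ (f ⊛ h) n + (g ⊛ h) n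
⊛-distribʳ-+ f g h zero    = eq (f 0) (g 0) (h 0)
  where
  eq : ∀ x y z → (x + y) * z + 0ℤ ≡ (x * z + 0ℤ) + (y * z + 0ℤ)
  eq = ℤ-Solver.solve-∀
⊛-distribʳ-+ f g h (suc n) =
  trans (cong (λ s → (f 0 + g 0) * h (suc n) + s) (⊛-distribʳ-+ (f ∘ suc) (g ∘ suc) h n))
        (eq (f 0) (g 0) (h (suc n)) _ _)
  where
  eq : ∀ x y z s t → (x + y) * z + (s + t) ≡ (x * z + s) + (y * z + t)
  eq = ℤ-Solver.solve-∀

⊛-scaleˡ : ∀ a f g n → ((λ i → a * f i) ⊛ g) n ≡ a * (f ⊛ g) n
⊛-scaleˡ a f g zero    = eq a (f 0) (g 0)
  where
  eq : ∀ a x y → a * x * y + 0ℤ ≡ a * (x * y + 0ℤ)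
  eq = ℤ-Solver.solve-∀
⊛-scaleˡ a f g (suc n) =
  trans (cong (λ s → a * f 0 * g (suc n) + s) (⊛-scaleˡ a (f ∘ suc) g n))
        (eq a (f 0) (g (suc n)) _)
  where
  eq : ∀ a x y s → a * x * y + a * s ≡ a * (x * y + s)
  eq = ℤ-Solver.solve-∀

⊛-zeroˡ : ∀ g n → ((λ _ → 0ℤ) ⊛ g) n ≡ 0ℤ
⊛-zeroˡ g zero    = refl
⊛-zeroˡ g (suc n) = trans (ℤ.+-identityˡ _) (⊛-zeroˡ g n)

⊛-∑ : ∀ (u : ℕ → PowerSeries) g N n →
  ((λ j → ∑[ i < N ] u (toℕ i) j) ⊛ g) n ≡ ∑[ i < N ] (u (toℕ i) ⊛ g) n
⊛-∑ u g zero    n = ⊛-zeroˡ g n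
⊛-∑ u g (suc N) n =
  trans (⊛-distribʳ-+ (u 0) (λ j → ∑[ i < N ] u (suc (toℕ i)) j) g n)
        (cong (λ s → (u 0 ⊛ g) n + s) (⊛-∑ (u ∘ suc) g N n))

-- Induction on the coefficient: `(f ⊛ g) ∘ suc` unfolds to `f 0` times `g ∘ suc` plus
-- `(f ∘ suc) ⊛ g`, and `⊛` by `h` distributes over this sum.
⊛-assoc : ∀ f g h → (f ⊛ g) ⊛ h ≗ f ⊛ (g ⊛ h)
⊛-assoc f g h zero    = eq (f 0) (g 0) (h 0)
  where
  eq : ∀ x y z → (x * y + 0ℤ) * z + 0ℤ ≡ x * (y * z + 0ℤ) + 0ℤ
  eq = ℤ-Solver.solve-∀
⊛-assoc f g h (suc n) = begin
  (f 0 * g 0 + 0ℤ) * h (suc n) + ((λ i → f 0 * g (suc i) + ((f ∘ suc) ⊛ g) i) ⊛ h) n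
    ≡⟨ cong (λ s → (f 0 * g 0 + 0ℤ) * h (suc n) + s)
         (⊛-distribʳ-+ (λ i → f 0 * g (suc i)) ((f ∘ suc) ⊛ g) h n) ⟩
  (f 0 * g 0 + 0ℤ) * h (suc n)
    + (((λ i → f 0 * g (suc i)) ⊛ h) n + (((f ∘ suc) ⊛ g) ⊛ h) n)
    ≡⟨ cong₂ (λ s t → (f 0 * g 0 + 0ℤ) * h (suc n) + (s + t))
         (⊛-scaleˡ (f 0) (g ∘ suc) h n) (⊛-assoc (f ∘ suc) g h n) ⟩
  (f 0 * g 0 + 0ℤ) * h (suc n) + (f 0 * ((g ∘ suc) ⊛ h) n + ((f ∘ suc) ⊛ (g ⊛ h)) n)
    ≡⟨ eq (f 0) (g 0) (h (suc n)) _ _ ⟩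
  f 0 * (g 0 * h (suc n) + ((g ∘ suc) ⊛ h) n) + ((f ∘ suc) ⊛ (g ⊛ h)) n ∎
  where
  open ≡-Reasoning
  eq : ∀ x y z s t → (x * y + 0ℤ) * z + (x * s + t) ≡ x * (y * z + s) + t
  eq = ℤ-Solver.solve-∀

-- Splits off the last term of the convolution, whereas the definition splits off the first;
-- commutativity compares the two.
⊛-sucʳ : ∀ f g n → (f ⊛ g) (suc n) ≡ (f ⊛ (g ∘ suc)) n + f (suc n) * g 0
⊛-sucʳ f g zero    = eq (f 0 * g 1) (f 1 * g 0)
  where
  eq : ∀ x y → x + (y + 0ℤ) ≡ x + 0ℤ + y
  eq = ℤ-Solver.solve-∀
⊛-sucʳ f g (suc n) =
  trans (cong (λ s → f 0 * g (suc (suc n)) + s) (⊛-sucʳ (f ∘ suc) g n))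
        (sym (ℤ.+-assoc (f 0 * g (suc (suc n))) _ _))

⊛-comm : ∀ f g → f ⊛ g ≗ g ⊛ f
⊛-comm f g zero    = cong (_+ 0ℤ) (ℤ.*-comm (f 0) (g 0))
⊛-comm f g (suc n) = begin
  f 0 * g (suc n) + ((f ∘ suc) ⊛ g) n  ≡⟨ cong (λ s → f 0 * g (suc n) + s) (⊛-comm (f ∘ suc) g n) ⟩
  f 0 * g (suc n) + (g ⊛ (f ∘ suc)) n  ≡⟨ eq (f 0) (g (suc n)) _ ⟩
  (g ⊛ (f ∘ suc)) n + g (suc n) * f 0  ≡⟨ ⊛-sucʳ g f n ⟨
  (g ⊛ f) (suc n)                      ∎
  where
  open ≡-Reasoning
  eq : ∀ x y s → x * y + s ≡ s + y * x
  eq = ℤ-Solver.solve-∀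

-- Written with <ᵇ so that it evaluates fast on literals and both clauses of
-- the recursion in e and n hold definitionally.
shift : PowerSeries → ℕ → PowerSeries
shift f e n = if e <ᵇ suc n then f (n ∸ e) else 0ℤ

q^⊛ : ∀ e f → (q^ (+ e)) ⊛ f ≗ shift f e
𝟙⊛ : ∀ f → 𝟙 ⊛ f ≗ f

𝟙⊛ f zero    = trans (ℤ.+-identityʳ (1ℤ * f 0)) (ℤ.*-identityˡ (f 0))
𝟙⊛ f (suc n) = trans (cong₂ _+_ (ℤ.*-identityˡ (f (suc n))) (⊛-zeroˡ f n)) (ℤ.+-identityʳ (f (suc n)))

q^⊛ zero    f n       = 𝟙⊛ f n
q^⊛ (suc e) f zero    = refl
q^⊛ (suc e) f (suc n) = trans (ℤ.+-identityˡ _) (q^⊛ e f n)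

-- Division by 1 - qᵃ

1−q^⊛ : ∀ a f n → ((1−q^ a) ⊛ f) n ≡ f n - shift f a n
1−q^⊛ a f n = begin
  ((λ i → 𝟙 i - (q^ (+ a)) i) ⊛ f) n
    ≡⟨ ⊛-distribʳ-+ 𝟙 (λ i → - (q^ (+ a)) i) f n ⟩
  (𝟙 ⊛ f) n + ((λ i → - (q^ (+ a)) i) ⊛ f) n
    ≡⟨ cong₂ _+_ (𝟙⊛ f n) (⊛-congˡ f n λ i _ → sym (ℤ.-1*i≡-i ((q^ (+ a)) i))) ⟩
  f n + ((λ i → -1ℤ * (q^ (+ a)) i) ⊛ f) n
    ≡⟨ cong (λ s → f n + s) (trans (⊛-scaleˡ -1ℤ (q^ (+ a)) f n) (ℤ.-1*i≡-i _)) ⟩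
  f n - ((q^ (+ a)) ⊛ f) n
    ≡⟨ cong (λ s → f n - s) (q^⊛ a f n) ⟩
  f n - shift f a n ∎
  where open ≡-Reasoning

-- The sum of f(n - i a) over 0 ≤ i ≤ j. The explicit count `j` makes the recursion structural; for
-- j = ⌊n / a⌋ no subtraction is truncated.
steps : ℕ → PowerSeries → ℕ → PowerSeries
steps a f zero    n = f n
steps a f (suc j) n = f n + steps a f j (n ∸ a)

-- f / (1 − qᵃ)
geom : (a : ℕ) .{{_ : NonZero a}} → PowerSeries → PowerSeries
geom a f n = steps a f (n ℕ./ a) n

geom-< : ∀ a .{{_ : NonZero a}} f {n} → n ℕ.< a → geom a f n ≡ f n
geom-< a f {n} n<a = cong (λ j → steps a f j n) (ℕ.m<n⇒m/n≡0 n<a)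

geom-+ : ∀ a .{{_ : NonZero a}} f n → geom a f (a ℕ.+ n) ≡ f (a ℕ.+ n) + geom a f n
geom-+ a f n = begin
  steps a f ((a ℕ.+ n) ℕ./ a) (a ℕ.+ n)
    ≡⟨ cong (λ j → steps a f j (a ℕ.+ n)) (ℕ.m/n≡1+[m∸n]/n (ℕ.m≤m+n a n)) ⟩
  f (a ℕ.+ n) + steps a f ((a ℕ.+ n ∸ a) ℕ./ a) (a ℕ.+ n ∸ a)
    ≡⟨ cong (λ m → f (a ℕ.+ n) + geom a f m) (ℕ.m+n∸m≡n a n) ⟩
  f (a ℕ.+ n) + geom a f n ∎
  where open ≡-Reasoning

shift-< : ∀ f {e n} → n ℕ.< e → shift f e n ≡ 0ℤ
shift-< f {suc e} {zero}  _         = refl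
shift-< f {suc e} {suc n} (s≤s n<e) = shift-< f n<e

shift-+ : ∀ f e n → shift f e (e ℕ.+ n) ≡ f n
shift-+ f zero    n = refl
shift-+ f (suc e) n = shift-+ f e n

1−q^⊛geom : ∀ a .{{_ : NonZero a}} f → (1−q^ a) ⊛ geom a f ≗ f
1−q^⊛geom a f n with ℕ.<-≤-connex n a
... | inj₁ n<a = trans (1−q^⊛ a (geom a f) n)
  (trans (cong₂ _-_ (geom-< a f n<a) (shift-< (geom a f) n<a)) (ℤ.+-identityʳ (f n)))
... | inj₂ a≤n with ℕ.m≤n⇒∃[o]m+o≡n a≤n
...   | m , refl = trans (1−q^⊛ a (geom a f) n)
  (trans (cong₂ _-_ (geom-+ a f m) (shift-+ (geom a f) a m)) (cancel (f n) (geom a f m)))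
  where
  cancel : ∀ x y → (x + y) - y ≡ x
  cancel = ℤ-Solver.solve-∀

-- Inverses are unique in a commutative ring, and the iterated geometric series is also inverse to
-- the denominator: its three factors cancel one after another.
1/denominator≗geom : ∀ a b c .{{_ : NonZero a}} .{{_ : NonZero b}} .{{_ : NonZero c}} →
  1/ denominator a b c ≗ geom c (geom b (geom a 𝟙))
1/denominator≗geom a b c n = begin
  (1/ d) n               ≡⟨ 𝟙⊛ (1/ d) n ⟨
  (𝟙 ⊛ 1/ d) n           ≡⟨ ⊛-comm 𝟙 (1/ d) n ⟩
  (1/ d ⊛ 𝟙) n           ≡⟨ ⊛-congʳ (1/ d) (λ i → sym (d⊛g≗𝟙 i)) n ⟩
  (1/ d ⊛ (d ⊛ g)) n     ≡⟨ ⊛-assoc (1/ d) d g n ⟨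
  ((1/ d ⊛ d) ⊛ g) n     ≡⟨ ⊛-congˡ g n (λ i _ → trans (⊛-comm (1/ d) d i)
                               (denominator-inverse a b c (ℕ.>-nonZero⁻¹ a) (ℕ.>-nonZero⁻¹ b) (ℕ.>-nonZero⁻¹ c) i)) ⟩
  (𝟙 ⊛ g) n              ≡⟨ 𝟙⊛ g n ⟩
  g n                    ∎
  where
  open ≡-Reasoning
  d = denominator a b c
  g = geom c (geom b (geom a 𝟙))
  d⊛g≗𝟙 : d ⊛ g ≗ 𝟙
  d⊛g≗𝟙 i = begin
    (d ⊛ g) i
      ≡⟨ ⊛-assoc ((1−q^ a) ⊛ (1−q^ b)) (1−q^ c) g i ⟩
    ((1−q^ a) ⊛ (1−q^ b) ⊛ ((1−q^ c) ⊛ g)) i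
      ≡⟨ ⊛-congʳ ((1−q^ a) ⊛ (1−q^ b)) (1−q^⊛geom c (geom b (geom a 𝟙))) i ⟩
    ((1−q^ a) ⊛ (1−q^ b) ⊛ geom b (geom a 𝟙)) i
      ≡⟨ ⊛-assoc (1−q^ a) (1−q^ b) (geom b (geom a 𝟙)) i ⟩
    ((1−q^ a) ⊛ ((1−q^ b) ⊛ geom b (geom a 𝟙))) i
      ≡⟨ ⊛-congʳ (1−q^ a) (1−q^⊛geom b (geom a 𝟙)) i ⟩
    ((1−q^ a) ⊛ geom a 𝟙) i
      ≡⟨ 1−q^⊛geom a 𝟙 i ⟩
    𝟙 i ∎

-- The alternating sum of gaps

-- The triangular numbers with index 2 m and 2 m + 1, which are the exponents
-- 2 j² + j for j = m and j = − m − 1.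
evenTri oddTri : ℕ → ℕ
evenTri m = m ℕ.* (2 ℕ.* m ℕ.+ 1)
oddTri  m = suc m ℕ.* (2 ℕ.* m ℕ.+ 1)

gap : PowerSeries → ℕ → ℕ → ℤ
gap f n m = shift f (evenTri m) n - shift f (oddTri m) n

altSum : (ℕ → ℤ) → ℕ → ℕ → ℤ
altSum d m zero    = 0ℤ
altSum d m (suc N) = d m - altSum d (suc m) N

-1^[k+i+k] : ∀ k i → -1ℤ ^ (k ℕ.+ i ℕ.+ k) ≡ -1ℤ ^ i
-1^[k+i+k] k i = begin
  -1ℤ ^ (k ℕ.+ i ℕ.+ k)         ≡⟨ ℤ.^-distribˡ-+-* -1ℤ (k ℕ.+ i) k ⟩
  -1ℤ ^ (k ℕ.+ i) * -1ℤ ^ k     ≡⟨ cong (_* -1ℤ ^ k) (ℤ.^-distribˡ-+-* -1ℤ k i) ⟩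
  -1ℤ ^ k * -1ℤ ^ i * -1ℤ ^ k   ≡⟨ eq (-1ℤ ^ k) (-1ℤ ^ i) ⟩
  -1ℤ ^ k * -1ℤ ^ k * -1ℤ ^ i   ≡⟨ cong (_* -1ℤ ^ i) (square k) ⟩
  1ℤ * -1ℤ ^ i                  ≡⟨ ℤ.*-identityˡ (-1ℤ ^ i) ⟩
  -1ℤ ^ i                       ∎
  where
  open ≡-Reasoning
  eq : ∀ x y → x * y * x ≡ x * x * y
  eq = ℤ-Solver.solve-∀
  square : ∀ k → -1ℤ ^ k * -1ℤ ^ k ≡ 1ℤ
  square zero    = refl
  square (suc k) = trans (eq′ (-1ℤ ^ k)) (square k)
    where
    eq′ : ∀ x → -1ℤ * x * (-1ℤ * x) ≡ x * x
    eq′ = ℤ-Solver.solve-∀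

-- Exponent and sign enter as natural numbers, so that one lemma serves both j = m and j = - m - 1.
summand-⊛ : ∀ k j e s f → + 2 * (j * j) + + 1 * j ≡ + e → ∣ j + + k ∣ ≡ s →
  ∀ n → (summand 2 1 k j ⊛ f) n ≡ -1ℤ ^ s * shift f e n
summand-⊛ k j e s f exp≡ sign≡ n = begin
  (summand 2 1 k j ⊛ f) n
    ≡⟨ ⊛-scaleˡ (-1ℤ ^ ∣ j + + k ∣) (q^ (+ 2 * (j * j) + + 1 * j)) f n ⟩
  -1ℤ ^ ∣ j + + k ∣ * ((q^ (+ 2 * (j * j) + + 1 * j)) ⊛ f) n
    ≡⟨ cong₂ (λ s e → -1ℤ ^ s * ((q^ e) ⊛ f) n) sign≡ exp≡ ⟩
  -1ℤ ^ s * ((q^ (+ e)) ⊛ f) n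
    ≡⟨ cong (λ x → -1ℤ ^ s * x) (q^⊛ e f n) ⟩
  -1ℤ ^ s * shift f e n ∎
  where open ≡-Reasoning

exponent-even : ∀ m → + 2 * (+ m * + m) + + 1 * + m ≡ + evenTri m
exponent-even m = begin
  + 2 * (+ m * + m) + + 1 * + m  ≡⟨ eq (+ m) ⟩
  + m * (+ 2 * + m + 1ℤ)         ≡⟨ cong (λ x → + m * (x + 1ℤ)) (ℤ.pos-* 2 m) ⟨
  + m * + (2 ℕ.* m ℕ.+ 1)        ≡⟨ ℤ.pos-* m (2 ℕ.* m ℕ.+ 1) ⟨
  + evenTri m                    ∎
  where
  open ≡-Reasoning
  eq : ∀ x → + 2 * (x * x) + + 1 * x ≡ x * (+ 2 * x + 1ℤ)
  eq = ℤ-Solver.solve-∀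

exponent-odd : ∀ m → + 2 * (-[1+ m ] * -[1+ m ]) + + 1 * -[1+ m ] ≡ + oddTri m
exponent-odd m = begin
  + 2 * (- (1ℤ + + m) * - (1ℤ + + m)) + + 1 * - (1ℤ + + m)  ≡⟨ eq (+ m) ⟩
  (1ℤ + + m) * (+ 2 * + m + 1ℤ)         ≡⟨ cong (λ x → + suc m * (x + 1ℤ)) (ℤ.pos-* 2 m) ⟨
  + suc m * + (2 ℕ.* m ℕ.+ 1)           ≡⟨ ℤ.pos-* (suc m) (2 ℕ.* m ℕ.+ 1) ⟨
  + oddTri m                            ∎
  where
  open ≡-Reasoning
  eq : ∀ x → + 2 * (- (1ℤ + x) * - (1ℤ + x)) + + 1 * - (1ℤ + x) ≡ (1ℤ + x) * (+ 2 * x + 1ℤ)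
  eq = ℤ-Solver.solve-∀

-- The factor `s` is there for the induction: passing to the tail turns `s` into `- s`.
∑-alternating : ∀ (h d : ℕ → ℤ) k s → (∀ i → h i ≡ s * (-1ℤ ^ i * d (k ℕ.+ i))) →
  ∀ N → ∑[ i < N ] h (toℕ i) ≡ s * altSum d k N
∑-alternating h d k s h≡ zero    = sym (ℤ.*-zeroʳ s)
∑-alternating h d k s h≡ (suc N) = begin
  h 0 + ∑[ i < N ] h (suc (toℕ i))
    ≡⟨ cong₂ _+_ (h≡ 0) (∑-alternating (h ∘ suc) d (suc k) (- s) h-suc N) ⟩
  s * (1ℤ * d (k ℕ.+ 0)) + - s * altSum d (suc k) N
    ≡⟨ cong (λ m → s * (1ℤ * d m) + - s * altSum d (suc k) N) (ℕ.+-identityʳ k) ⟩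
  s * (1ℤ * d k) + - s * altSum d (suc k) N
    ≡⟨ eq s (d k) _ ⟩
  s * (d k - altSum d (suc k) N) ∎
  where
  open ≡-Reasoning
  eq : ∀ s x y → s * (1ℤ * x) + - s * y ≡ s * (x - y)
  eq = ℤ-Solver.solve-∀
  eq′ : ∀ s x y → s * (-1ℤ * x * y) ≡ - s * (x * y)
  eq′ = ℤ-Solver.solve-∀
  h-suc : ∀ i → h (suc i) ≡ - s * (-1ℤ ^ i * d (suc k ℕ.+ i))
  h-suc i = trans (h≡ (suc i))
    (trans (cong (λ m → s * (-1ℤ ^ suc i * d m)) (ℕ.+-suc k i)) (eq′ s (-1ℤ ^ i) (d (suc k ℕ.+ i))))

tailSum-⊛ : ∀ k f n → (tailSum 2 1 k ⊛ f) n ≡ altSum (gap f n) k (suc n)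
tailSum-⊛ k f n = begin
  (tailSum 2 1 k ⊛ f) n
    -- `tailSum` cuts off at a point depending on the coefficient. Up to qⁿ it agrees with the one
    -- partial sum of length n + 1, a finite sum of series through which `⊛` distributes.
    ≡⟨ ⊛-congˡ f n (λ i i≤n → sym (partialSum-stable 2 1 k i (suc n) (s≤s z≤n) (s≤s z≤n) (s≤s i≤n))) ⟩
  (partialSum 2 1 k (suc n) ⊛ f) n
    ≡⟨ ⊛-∑ (λ i j → summand 2 1 k (+ (k ℕ.+ i)) j + summand 2 1 k -[1+ k ℕ.+ i ] j) f (suc n) n ⟩
  ∑[ i < suc n ] ((λ j → summand 2 1 k (+ (k ℕ.+ toℕ i)) j + summand 2 1 k -[1+ k ℕ.+ toℕ i ] j) ⊛ f) n
    ≡⟨ ∑-alternating (λ i → ((λ j → summand 2 1 k (+ (k ℕ.+ i)) j + summand 2 1 k -[1+ k ℕ.+ i ] j) ⊛ f) n)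
         (gap f n) k 1ℤ term (suc n) ⟩
  1ℤ * altSum (gap f n) k (suc n)
    ≡⟨ ℤ.*-identityˡ _ ⟩
  altSum (gap f n) k (suc n) ∎
  where
  open ≡-Reasoning
  eq : ∀ s x y → s * x + -1ℤ * s * y ≡ 1ℤ * (s * (x - y))
  eq = ℤ-Solver.solve-∀
  term : ∀ i → ((λ j → summand 2 1 k (+ (k ℕ.+ i)) j + summand 2 1 k -[1+ k ℕ.+ i ] j) ⊛ f) n
    ≡ 1ℤ * (-1ℤ ^ i * gap f n (k ℕ.+ i))
  term i = begin
    ((λ j → summand 2 1 k (+ m) j + summand 2 1 k -[1+ m ] j) ⊛ f) n
      ≡⟨ ⊛-distribʳ-+ (summand 2 1 k (+ m)) (summand 2 1 k -[1+ m ]) f n ⟩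
    (summand 2 1 k (+ m) ⊛ f) n + (summand 2 1 k -[1+ m ] ⊛ f) n
      ≡⟨ cong₂ _+_ (summand-⊛ k (+ m) (evenTri m) (m ℕ.+ k) f (exponent-even m) refl n)
           (summand-⊛ k -[1+ m ] (oddTri m) (suc i) f (exponent-odd m) ∣k-1-m∣≡1+i n) ⟩
    -1ℤ ^ (m ℕ.+ k) * shift f (evenTri m) n + -1ℤ ^ suc i * shift f (oddTri m) n
      ≡⟨ cong (λ s → s * shift f (evenTri m) n + -1ℤ ^ suc i * shift f (oddTri m) n) (-1^[k+i+k] k i) ⟩
    -1ℤ ^ i * shift f (evenTri m) n + -1ℤ ^ suc i * shift f (oddTri m) n
      ≡⟨ eq (-1ℤ ^ i) (shift f (evenTri m) n) (shift f (oddTri m) n) ⟩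
    1ℤ * (-1ℤ ^ i * gap f n m) ∎
    where
    m = k ℕ.+ i
    ∣k-1-m∣≡1+i : ∣ k ⊖ suc m ∣ ≡ suc i
    ∣k-1-m∣≡1+i = trans (ℤ.∣⊖∣-≤ (ℕ.m≤n⇒m≤1+n (ℕ.m≤m+n k i)))
      (trans (cong (_∸ k) (sym (ℕ.+-suc k i))) (ℕ.m+n∸m≡n k (suc i)))

γ≡altSum : ∀ a b c .{{_ : NonZero a}} .{{_ : NonZero b}} .{{_ : NonZero c}} k n →
  γ a b c 2 1 k n ≡ altSum (gap (geom c (geom b (geom a 𝟙))) n) k (suc n)
γ≡altSum a b c k n = begin
  (1/ denominator a b c ⊛ tailSum 2 1 k) n
    ≡⟨ ⊛-congˡ (tailSum 2 1 k) n (λ i _ → 1/denominator≗geom a b c i) ⟩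
  (geom c (geom b (geom a 𝟙)) ⊛ tailSum 2 1 k) n
    ≡⟨ ⊛-comm (geom c (geom b (geom a 𝟙))) (tailSum 2 1 k) n ⟩
  (tailSum 2 1 k ⊛ geom c (geom b (geom a 𝟙))) n
    ≡⟨ tailSum-⊛ k (geom c (geom b (geom a 𝟙))) n ⟩
  altSum (gap (geom c (geom b (geom a 𝟙))) n) k (suc n) ∎
  where open ≡-Reasoning

-- Partitions into parts 1, b and c

period-induction : ∀ (Q : ℕ → Set) p .{{_ : NonZero p}} →
  (∀ {x} → x ℕ.< p → Q x) → (∀ x → Q x → Q (p ℕ.+ x)) → ∀ x → Q x
period-induction Q p base step x =
  subst Q (trans (ℕ.+-comm (x ℕ./ p ℕ.* p) (x ℕ.% p)) (sym (ℕ.m≡m%n+[m/n]*n x p))) (go (x ℕ./ p))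
  where
  go : ∀ j → Q (j ℕ.* p ℕ.+ x ℕ.% p)
  go zero    = base (ℕ.m%n<n x p)
  go (suc j) = subst Q (sym (ℕ.+-assoc p (j ℕ.* p) (x ℕ.% p))) (step _ (go j))

parts₂ : (b : ℕ) .{{_ : NonZero b}} → PowerSeries
parts₂ b = geom b (geom 1 𝟙)

parts₃ : (b c : ℕ) .{{_ : NonZero b}} .{{_ : NonZero c}} → PowerSeries
parts₃ b c = geom c (parts₂ b)

geom-1-𝟙 : ∀ n → geom 1 𝟙 n ≡ 1ℤ
geom-1-𝟙 zero    = refl
geom-1-𝟙 (suc n) = trans (geom-+ 1 𝟙 n) (trans (ℤ.+-identityˡ _) (geom-1-𝟙 n))

parts₂-+ : ∀ b .{{_ : NonZero b}} n → parts₂ b (b ℕ.+ n) ≡ 1ℤ + parts₂ b n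
parts₂-+ b n = trans (geom-+ b (geom 1 𝟙) n) (cong (_+ parts₂ b n) (geom-1-𝟙 (b ℕ.+ n)))

module _ (b c : ℕ) .{{_ : NonZero b}} .{{_ : NonZero c}} where

  -- The sum of `parts₂ b` at i c + x for 1 ≤ i ≤ j, which is the growth of `parts₃ b c` from x over
  -- j steps of length c.
  column : ℕ → ℕ → ℤ
  column zero    x = 0ℤ
  column (suc j) x = parts₂ b (c ℕ.+ (j ℕ.* c ℕ.+ x)) + column j x

  parts₃-column : ∀ j x → parts₃ b c (j ℕ.* c ℕ.+ x) ≡ column j x + parts₃ b c x
  parts₃-column zero    x = sym (ℤ.+-identityˡ _)
  parts₃-column (suc j) x = begin
    parts₃ b c (c ℕ.+ j ℕ.* c ℕ.+ x)    ≡⟨ cong (parts₃ b c) (ℕ.+-assoc c (j ℕ.* c) x) ⟩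
    parts₃ b c (c ℕ.+ y)                ≡⟨ geom-+ c (parts₂ b) y ⟩
    parts₂ b (c ℕ.+ y) + parts₃ b c y   ≡⟨ cong (λ s → parts₂ b (c ℕ.+ y) + s) (parts₃-column j x) ⟩
    parts₂ b (c ℕ.+ y) + (column j x + parts₃ b c x) ≡⟨ ℤ.+-assoc (parts₂ b (c ℕ.+ y)) (column j x) _ ⟨
    column (suc j) x + parts₃ b c x     ∎
    where
    open ≡-Reasoning
    y = j ℕ.* c ℕ.+ x

  -- Each of the j values of `parts₂ b` grows by 1. For j = b this is the growth of x itself, so a
  -- formula x + K for `column b x` need only be checked for x < b.
  column-+ : ∀ j x → column j (b ℕ.+ x) ≡ + j + column j x
  column-+ zero    x = refl
  column-+ (suc j) x = begin
    parts₂ b (c ℕ.+ (j ℕ.* c ℕ.+ (b ℕ.+ x))) + column j (b ℕ.+ x)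
      ≡⟨ cong₂ (λ y s → parts₂ b y + s) (swap c (j ℕ.* c) b x) (column-+ j x) ⟩
    parts₂ b (b ℕ.+ y) + (+ j + column j x)
      ≡⟨ cong (_+ (+ j + column j x)) (parts₂-+ b y) ⟩
    1ℤ + parts₂ b y + (+ j + column j x)
      ≡⟨ eq (parts₂ b y) (+ j) (column j x) ⟩
    1ℤ + + j + (parts₂ b y + column j x) ∎
    where
    open ≡-Reasoning
    y = c ℕ.+ (j ℕ.* c ℕ.+ x)
    swap : ∀ c d b x → c ℕ.+ (d ℕ.+ (b ℕ.+ x)) ≡ b ℕ.+ (c ℕ.+ (d ℕ.+ x))
    swap = ℕ-Solver.solve-∀
    eq : ∀ p j s → 1ℤ + p + (j + s) ≡ 1ℤ + j + (p + s)
    eq = ℤ-Solver.solve-∀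

  H scale : ℕ
  H     = 1 ℕ.+ b ℕ.+ c
  scale = 8 ℕ.* (b ℕ.* c)

  mainTerm : ℕ → ℕ
  mainTerm x = (2 ℕ.* x ℕ.+ H) ℕ.* (2 ℕ.* x ℕ.+ H)

  remainder : ℕ → ℤ
  remainder x = + scale * parts₃ b c x - + mainTerm x

  +mainTerm : ∀ x → + mainTerm x ≡ (+ 2 * + x + + H) * (+ 2 * + x + + H)
  +mainTerm x = trans (ℤ.pos-* (2 ℕ.* x ℕ.+ H) (2 ℕ.* x ℕ.+ H)) (cong (λ y → (y + + H) * (y + + H)) (ℤ.pos-* 2 x))

  +scale : + scale ≡ + 8 * (+ b * + c)
  +scale = trans (ℤ.pos-* 8 (b ℕ.* c)) (cong (+ 8 *_) (ℤ.pos-* b c))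

  module _ (K : ℕ) (2K≡[1+b][1+c] : 2 ℕ.* K ≡ suc b ℕ.* suc c)
           (column≡ : ∀ {x} → x ℕ.< b → column b x ≡ + x + + K) where

    parts₃-period : ∀ x → parts₃ b c (b ℕ.* c ℕ.+ x) ≡ parts₃ b c x + (+ x + + K)
    parts₃-period x = begin
      parts₃ b c (b ℕ.* c ℕ.+ x)      ≡⟨ parts₃-column b x ⟩
      column b x + parts₃ b c x       ≡⟨ ℤ.+-comm (column b x) (parts₃ b c x) ⟩
      parts₃ b c x + column b x       ≡⟨ cong (λ s → parts₃ b c x + s) (column≡′ x) ⟩
      parts₃ b c x + (+ x + + K)      ∎
      where
      open ≡-Reasoning
      column≡′ : ∀ x → column b x ≡ + x + + K
      column≡′ = period-induction _ b column≡ λ x ih →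
        trans (column-+ b x) (trans (cong (λ s → + b + s) ih) (sym (ℤ.+-assoc (+ b) (+ x) (+ K))))

    -- Over one period b c the square (2 x + H)² grows by 4 b c (2 x + b c + H), and `scale` times
    -- `parts₃` by 8 b c (x + K). These agree because 2 K = b c + H = (1 + b) (1 + c).
    remainder-period : ∀ x → remainder (b ℕ.* c ℕ.+ x) ≡ remainder x
    remainder-period x = begin
      + scale * parts₃ b c (b ℕ.* c ℕ.+ x) - + mainTerm (b ℕ.* c ℕ.+ x)
        ≡⟨ cong₂ (λ p m → + scale * p - m) (parts₃-period x) (+mainTerm (b ℕ.* c ℕ.+ x)) ⟩
      + scale * (p + (+ x + + K)) - (+ 2 * (+ (b ℕ.* c) + + x) + + H) * (+ 2 * (+ (b ℕ.* c) + + x) + + H)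
        ≡⟨ cong₂ (λ s y → s * (p + (+ x + + K)) - (+ 2 * (y + + x) + + H) * (+ 2 * (y + + x) + + H)) +scale (ℤ.pos-* b c) ⟩
      + 8 * (+ b * + c) * (p + (+ x + + K)) - (+ 2 * (+ b * + c + + x) + (1ℤ + + b + + c)) * (+ 2 * (+ b * + c + + x) + (1ℤ + + b + + c))
        ≡⟨ eq (+ b) (+ c) p (+ x) (+ K) ⟩
      + 8 * (+ b * + c) * p - (+ 2 * + x + + H) * (+ 2 * + x + + H) + + 4 * (+ b * + c) * (+ 2 * + K - (1ℤ + + b) * (1ℤ + + c))
        ≡⟨ cong₂ (λ s m → s * p - m + + 4 * (+ b * + c) * (+ 2 * + K - (1ℤ + + b) * (1ℤ + + c))) +scale (+mainTerm x) ⟨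
      remainder x + + 4 * (+ b * + c) * (+ 2 * + K - (1ℤ + + b) * (1ℤ + + c))
        ≡⟨ cong (λ k → remainder x + + 4 * (+ b * + c) * (k - (1ℤ + + b) * (1ℤ + + c))) 2K≡ ⟩
      remainder x + + 4 * (+ b * + c) * ((1ℤ + + b) * (1ℤ + + c) - (1ℤ + + b) * (1ℤ + + c))
        ≡⟨ eq′ (remainder x) (+ 4 * (+ b * + c)) ((1ℤ + + b) * (1ℤ + + c)) ⟩
      remainder x ∎
      where
      open ≡-Reasoning
      p = parts₃ b c x
      2K≡ : + 2 * + K ≡ (1ℤ + + b) * (1ℤ + + c)
      2K≡ = trans (sym (ℤ.pos-* 2 K)) (trans (cong +_ 2K≡[1+b][1+c]) (ℤ.pos-* (suc b) (suc c)))
      eq : ∀ b c p x k →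
        + 8 * (b * c) * (p + (x + k)) - (+ 2 * (b * c + x) + (1ℤ + b + c)) * (+ 2 * (b * c + x) + (1ℤ + b + c))
        ≡ + 8 * (b * c) * p - (+ 2 * x + (1ℤ + b + c)) * (+ 2 * x + (1ℤ + b + c)) + + 4 * (b * c) * (+ 2 * k - (1ℤ + b) * (1ℤ + c))
      eq = ℤ-Solver.solve-∀
      eq′ : ∀ r s y → r + s * (y - y) ≡ r
      eq′ = ℤ-Solver.solve-∀

    instance
      _ = ℕ.m*n≢0 b c

    remainder-% : ∀ x → remainder x ≡ remainder (x ℕ.% (b ℕ.* c))
    remainder-% = period-induction _ (b ℕ.* c)
      (λ x<bc → cong remainder (sym (ℕ.m<n⇒m%n≡m x<bc)))
      (λ x ih → trans (remainder-period x) (trans ih (cong remainder (sym (%-+ x)))))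
      where
      %-+ : ∀ x → (b ℕ.* c ℕ.+ x) ℕ.% (b ℕ.* c) ≡ x ℕ.% (b ℕ.* c)
      %-+ x = trans (cong (ℕ._% (b ℕ.* c)) (ℕ.+-comm (b ℕ.* c) x)) (ℕ.[m+n]%n≡m%n x (b ℕ.* c))

    -- The increment x + K over a period is itself increasing in x, so monotonicity carries over
    -- from one period to the next.
    parts₃-mono : (∀ {x} → x ℕ.< b ℕ.* c → parts₃ b c x ≤ parts₃ b c (suc x)) →
      ∀ x → parts₃ b c x ≤ parts₃ b c (suc x)
    parts₃-mono base = period-induction _ (b ℕ.* c) base λ x p≤p′ →
      subst₂ _≤_ (sym (parts₃-period x))
        (sym (trans (cong (parts₃ b c) (sym (ℕ.+-suc (b ℕ.* c) x))) (parts₃-period (suc x))))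
        (ℤ.+-mono-≤ p≤p′ (ℤ.+-monoˡ-≤ (+ K) (+≤+ (ℕ.n≤1+n x))))

-- The main term of the alternating sum

infixl 6 _⊕_
infixl 7 _⊗_

-- With `⊕` and `⊗` a proof of nonnegativity mirrors a polynomial: the ring solver rewrites a
-- difference as a sum of products of nonnegative factors, and the proof term follows that
-- expression.
_⊕_ : ∀ {x y} → 0ℤ ≤ x → 0ℤ ≤ y → 0ℤ ≤ x + y
_⊕_ = ℤ.+-mono-≤

_⊗_ : ∀ {x y} → 0ℤ ≤ x → 0ℤ ≤ y → 0ℤ ≤ x * y
_⊗_ {+ m} {+ n} _ _ = subst (0ℤ ≤_) (ℤ.pos-* m n) (+≤+ z≤n)

0≤+ : ∀ n → 0ℤ ≤ + n
0≤+ n = +≤+ z≤n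

0≤n-m : ∀ {m n} → m ℕ.≤ n → 0ℤ ≤ + n - + m
0≤n-m m≤n = ℤ.i≤j⇒0≤j-i (+≤+ m≤n)

0≤i² : ∀ i → 0ℤ ≤ i * i
0≤i² (+ n)    = 0≤+ n ⊗ 0≤+ n
0≤i² -[1+ n ] = +≤+ z≤n

≤-from-difference : ∀ {x y z} → y - x ≡ z → 0ℤ ≤ z → x ≤ y
≤-from-difference eq 0≤z = ℤ.0≤i-j⇒j≤i (subst (0ℤ ≤_) (sym eq) 0≤z)

∣i∣≤n : ∀ i n → 0ℤ ≤ + n - i → 0ℤ ≤ + n + i → ∣ i ∣ ℕ.≤ n
∣i∣≤n (+ m)    n 0≤n-i 0≤n+i = ℤ.drop‿+≤+ (ℤ.0≤i-j⇒j≤i 0≤n-i)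
∣i∣≤n -[1+ m ] n 0≤n-i 0≤n+i = ℤ.drop‿+≤+ (ℤ.0≤i-j⇒j≤i {+ n} {+ suc m} 0≤n+i)

0≤-near : ∀ a g n → ∣ a - g ∣ ℕ.≤ n → + n ≤ g → 0ℤ ≤ a
0≤-near a g n near n≤g = subst (0ℤ ≤_) (eq a g (+ ∣ a - g ∣))
  (ℤ.i≤j⇒0≤j-i (ℤ.≤-trans (+≤+ near) n≤g) ⊕ 0≤∣i∣+i (a - g))
  where
  0≤∣i∣+i : ∀ i → 0ℤ ≤ + ∣ i ∣ + i
  0≤∣i∣+i (+ m)    = 0≤+ (m ℕ.+ m)
  0≤∣i∣+i -[1+ m ] = ℤ.≤-reflexive (sym (ℤ.n⊖n≡0 (suc m)))
  eq : ∀ a g n → (g - n) + (n + (a - g)) ≡ a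
  eq = ℤ-Solver.solve-∀

-- Even- and odd-indexed triangular numbers

+evenTri : ∀ m → + evenTri m ≡ + m * (+ 2 * + m + 1ℤ)
+evenTri m = trans (ℤ.pos-* m (2 ℕ.* m ℕ.+ 1)) (cong (λ x → + m * (x + 1ℤ)) (ℤ.pos-* 2 m))

+oddTri : ∀ m → + oddTri m ≡ (1ℤ + + m) * (+ 2 * + m + 1ℤ)
+oddTri m = trans (ℤ.pos-* (suc m) (2 ℕ.* m ℕ.+ 1)) (cong (λ x → + suc m * (x + 1ℤ)) (ℤ.pos-* 2 m))

oddTri≡ : ∀ m → oddTri m ≡ evenTri m ℕ.+ (2 ℕ.* m ℕ.+ 1)
oddTri≡ m = ℕ.+-comm (2 ℕ.* m ℕ.+ 1) (evenTri m)

evenTri-suc : ∀ m → evenTri (suc m) ≡ evenTri m ℕ.+ (4 ℕ.* m ℕ.+ 3)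
evenTri-suc = eq
  where
  eq : ∀ m → suc m ℕ.* (2 ℕ.* suc m ℕ.+ 1) ≡ m ℕ.* (2 ℕ.* m ℕ.+ 1) ℕ.+ (4 ℕ.* m ℕ.+ 3)
  eq = ℕ-Solver.solve-∀

evenTri-mono : ∀ {m n} → m ℕ.≤ n → evenTri m ℕ.≤ evenTri n
evenTri-mono m≤n = ℕ.*-mono-≤ m≤n (ℕ.+-monoˡ-≤ 1 (ℕ.*-monoʳ-≤ 2 m≤n))

oddTri≤evenTri : ∀ {m n} → m ℕ.< n → oddTri m ℕ.≤ evenTri n
oddTri≤evenTri {m} m<n = ℕ.≤-trans
  (ℕ.*-monoʳ-≤ (suc m) (ℕ.+-monoˡ-≤ 1 (ℕ.*-monoʳ-≤ 2 (ℕ.n≤1+n m)))) (evenTri-mono m<n)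

-- The antidifference of the main term of the gaps: G(m) + G(m + 1) equals
-- (X − 2 T₂ₘ)² − (X − 2 T₂ₘ₊₁)² = 4 v (X − v²) with v = 2 m + 1.
G : ℤ → ℤ → ℤ
G X m = + 4 * m * (X + + 3 - + 4 * (m * m))

-- Error bounds for the alternating sum

module Estimate
  (f : PowerSeries) (L H : ℕ) .{{_ : Positive (+ L)}} (ε : ℕ → ℤ) (δ : ℤ) (w : ℕ)
  (Lf≡ : ∀ x → + L * f x ≡ (+ 2 * + x + + H) * (+ 2 * + x + + H) + ε x)
  -- Two shifts in one gap see only the deviation of ε from δ; a lone shift, possible in the last
  -- gap, also sees δ itself.
  (ε-near : ∀ x → ∣ ε x - δ ∣ ℕ.≤ w) (δ≤w : ∣ δ ∣ ℕ.≤ w)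
  where

  X : ℕ → ℤ
  X n = + 2 * + n + + H

  L*shift : ∀ e y → let n = e ℕ.+ y in
    + L * shift f e n ≡ (X n - + 2 * + e) * (X n - + 2 * + e) + ε y
  L*shift e y = begin
    + L * shift f e (e ℕ.+ y)   ≡⟨ cong (+ L *_) (shift-+ f e y) ⟩
    + L * f y                   ≡⟨ Lf≡ y ⟩
    (+ 2 * + y + + H) * (+ 2 * + y + + H) + ε y ≡⟨ cong (_+ ε y) (eq (+ e) (+ y) (+ H)) ⟩
    (X (e ℕ.+ y) - + 2 * + e) * (X (e ℕ.+ y) - + 2 * + e) + ε y ∎
    where
    open ≡-Reasoning
    eq : ∀ e y h → (+ 2 * y + h) * (+ 2 * y + h)
      ≡ (+ 2 * (e + y) + h - + 2 * e) * (+ 2 * (e + y) + h - + 2 * e)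
    eq = ℤ-Solver.solve-∀

  -- δ cancels between the two shifts.
  full-gap : ∀ m n → oddTri m ℕ.≤ n →
    ∣ + L * gap f n m - (G (X n) (+ m) + G (X n) (1ℤ + + m)) ∣ ℕ.≤ 2 ℕ.* w
  full-gap m n o≤n with ℕ.m≤n⇒∃[o]m+o≡n o≤n
  ... | y , refl = begin
    ∣ + L * gap f n m - (G (X n) (+ m) + G (X n) (1ℤ + + m)) ∣   ≡⟨ cong ∣_∣ difference ⟩
    ∣ (ε x - δ) - (ε y - δ) ∣            ≤⟨ ℤ.∣i-j∣≤∣i∣+∣j∣ (ε x - δ) (ε y - δ) ⟩
    ∣ ε x - δ ∣ ℕ.+ ∣ ε y - δ ∣         ≤⟨ ℕ.+-mono-≤ (ε-near x) (ε-near y) ⟩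
    w ℕ.+ w                              ≡⟨ cong (w ℕ.+_) (ℕ.+-identityʳ w) ⟨
    2 ℕ.* w                              ∎
    where
    open ℕ.≤-Reasoning
    x = 2 ℕ.* m ℕ.+ 1 ℕ.+ y
    e+x≡n : evenTri m ℕ.+ x ≡ n
    e+x≡n = trans (sym (ℕ.+-assoc (evenTri m) (2 ℕ.* m ℕ.+ 1) y)) (cong (ℕ._+ y) (sym (oddTri≡ m)))
    eq : ∀ X m ε₁ ε₂ δ →
      ((X - + 2 * (m * (+ 2 * m + 1ℤ))) * (X - + 2 * (m * (+ 2 * m + 1ℤ))) + ε₁)
      - ((X - + 2 * ((1ℤ + m) * (+ 2 * m + 1ℤ))) * (X - + 2 * ((1ℤ + m) * (+ 2 * m + 1ℤ))) + ε₂)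
      - (+ 4 * m * (X + + 3 - + 4 * (m * m)) + + 4 * (1ℤ + m) * (X + + 3 - + 4 * ((1ℤ + m) * (1ℤ + m))))
      ≡ (ε₁ - δ) - (ε₂ - δ)
    eq = ℤ-Solver.solve-∀
    distrib : ∀ l x y → l * (x - y) ≡ l * x - l * y
    distrib = ℤ-Solver.solve-∀
    L*shift-even : + L * shift f (evenTri m) n ≡ (X n - + 2 * + evenTri m) * (X n - + 2 * + evenTri m) + ε x
    L*shift-even = subst
      (λ i → + L * shift f (evenTri m) i ≡ (X i - + 2 * + evenTri m) * (X i - + 2 * + evenTri m) + ε x)
      e+x≡n (L*shift (evenTri m) x)
    g = G (X n) (+ m) + G (X n) (1ℤ + + m)
    difference : + L * gap f n m - g ≡ (ε x - δ) - (ε y - δ)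
    difference = ≡.begin
      + L * gap f n m - g
        ≡.≡⟨ cong (_- g) (distrib (+ L) (shift f (evenTri m) n) (shift f (oddTri m) n)) ⟩
      + L * shift f (evenTri m) n - + L * shift f (oddTri m) n - g
        ≡.≡⟨ cong₂ (λ s t → s - t - g) L*shift-even (L*shift (oddTri m) y) ⟩
      (X n - + 2 * + evenTri m) * (X n - + 2 * + evenTri m) + ε x
        - ((X n - + 2 * + oddTri m) * (X n - + 2 * + oddTri m) + ε y) - g
        ≡.≡⟨ cong₂ (λ s t → (X n - + 2 * s) * (X n - + 2 * s) + ε x
                        - ((X n - + 2 * t) * (X n - + 2 * t) + ε y) - g) (+evenTri m) (+oddTri m) ⟩
      _ ≡.≡⟨ eq (X n) (+ m) (ε x) (ε y) δ ⟩
      (ε x - δ) - (ε y - δ) ≡.∎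
      where module ≡ = ≡-Reasoning

  -- Telescoping from m = M down to m = k: the terms G(m) + G(m + 1) leave only G(k). Each of the j
  -- gaps below M adds an error 2 w, and the last gap adds B.
  altSum-near : ∀ n M B → evenTri M ℕ.≤ n →
    ∣ + L * gap f n M - G (X n) (+ M) ∣ ℕ.≤ B →
    ∀ j k → j ℕ.+ k ≡ M →
    ∣ + L * altSum (gap f n) k (suc j) - G (X n) (+ k) ∣ ℕ.≤ j ℕ.* (2 ℕ.* w) ℕ.+ B
  altSum-near n M B e≤n base zero    k refl =
    subst (λ d → ∣ + L * d - G (X n) (+ k) ∣ ℕ.≤ B) (sym (ℤ.+-identityʳ (gap f n k))) base
  altSum-near n M B e≤n base (suc j) k refl = begin
    ∣ + L * (d - s) - g ∣
      ≡⟨ cong ∣_∣ (eq (+ L) d s g g′) ⟩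
    ∣ (+ L * d - (g + g′)) - (+ L * s - g′) ∣
      ≤⟨ ℤ.∣i-j∣≤∣i∣+∣j∣ (+ L * d - (g + g′)) (+ L * s - g′) ⟩
    ∣ + L * d - (g + g′) ∣ ℕ.+ ∣ + L * s - g′ ∣
      ≤⟨ ℕ.+-mono-≤ (full-gap k n (ℕ.≤-trans (oddTri≤evenTri (s≤s (ℕ.m≤n+m k j))) e≤n))
           (altSum-near n M B e≤n base j (suc k) (ℕ.+-suc j k)) ⟩
    2 ℕ.* w ℕ.+ (j ℕ.* (2 ℕ.* w) ℕ.+ B)
      ≡⟨ ℕ.+-assoc (2 ℕ.* w) (j ℕ.* (2 ℕ.* w)) B ⟨
    suc j ℕ.* (2 ℕ.* w) ℕ.+ B ∎
    where
    open ℕ.≤-Reasoning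
    d = gap f n k
    s = altSum (gap f n) (suc k) (suc j)
    g = G (X n) (+ k)
    g′ = G (X n) (1ℤ + + k)
    eq : ∀ l d s g g′ → l * (d - s) - g ≡ (l * d - (g + g′)) - (l * s - g′)
    eq = ℤ-Solver.solve-∀

  -- The last gap is compared with G(M) alone, since no later gap cancels G(M + 1). As T₂ₘ₊₁ = T₂ₘ +
  -- 2 m + 1, for r ≤ 2 M only the even shift contributes; otherwise the gap is full and G(M + 1)
  -- counts as error.
  last-gap : ∀ M r → H ℕ.+ 3 ℕ.≤ M → r ℕ.< 4 ℕ.* M ℕ.+ 3 → let n = evenTri M ℕ.+ r in
    ∣ + L * gap f n M - G (X n) (+ M) ∣ ℕ.≤ 2 ℕ.* w ℕ.+ 12 ℕ.* (M ℕ.* suc M)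
  last-gap M r H+3≤M r<4M+3 with ℕ.≤-<-connex r (2 ℕ.* M)
  ... | inj₁ r≤2M = begin
    ∣ + L * gap f n M - G (X n) (+ M) ∣       ≡⟨ cong ∣_∣ split ⟩
    ∣ (ε r - δ) + δ + V ∣                    ≤⟨ ℤ.∣i+j∣≤∣i∣+∣j∣ ((ε r - δ) + δ) V ⟩
    ∣ (ε r - δ) + δ ∣ ℕ.+ ∣ V ∣              ≤⟨ ℕ.+-mono-≤ (ℤ.∣i+j∣≤∣i∣+∣j∣ (ε r - δ) δ) ∣V∣≤ ⟩
    ∣ ε r - δ ∣ ℕ.+ ∣ δ ∣ ℕ.+ R              ≤⟨ ℕ.+-monoˡ-≤ R (ℕ.+-mono-≤ (ε-near r) δ≤w) ⟩
    w ℕ.+ w ℕ.+ R                            ≡⟨ cong (λ x → w ℕ.+ x ℕ.+ R) (ℕ.+-identityʳ w) ⟨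
    2 ℕ.* w ℕ.+ R                            ∎
    where
    open ℕ.≤-Reasoning
    n = evenTri M ℕ.+ r
    R = 12 ℕ.* (M ℕ.* suc M)
    y = + 2 * + r + + H
    -- Here X = 2 T₂ₘ + y with m = M, so `V` is y² - G(M).
    V = y * y - + 4 * + M * (+ 2 * + M + y + + 3)
    +R : + R ≡ + 12 * (+ M * (1ℤ + + M))
    +R = trans (ℤ.pos-* 12 (M ℕ.* suc M)) (cong (+ 12 *_) (ℤ.pos-* M (suc M)))
    n<oddTri : n ℕ.< oddTri M
    n<oddTri = subst (n ℕ.<_) (sym (oddTri≡ M)) (ℕ.+-monoʳ-< (evenTri M) (subst (r ℕ.<_) (ℕ.+-comm 1 (2 ℕ.* M)) (s≤s r≤2M)))
    gap≡ : gap f n M ≡ f r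
    gap≡ = trans (cong₂ _-_ (shift-+ f (evenTri M) r) (shift-< f n<oddTri)) (ℤ.+-identityʳ (f r))
    split : + L * gap f n M - G (X n) (+ M) ≡ (ε r - δ) + δ + V
    split = ≡.begin
      + L * gap f n M - G (X n) (+ M)
        ≡.≡⟨ cong₂ (λ s e → s - G (+ 2 * (e + + r) + + H) (+ M)) (trans (cong (+ L *_) gap≡) (Lf≡ r)) (+evenTri M) ⟩
      _ ≡.≡⟨ eq (+ M) (+ r) (+ H) (ε r) δ ⟩
      (ε r - δ) + δ + V ≡.∎
      where
      module ≡ = ≡-Reasoning
      eq : ∀ M r h ε δ →
        (+ 2 * r + h) * (+ 2 * r + h) + ε - + 4 * M * (+ 2 * (M * (+ 2 * M + 1ℤ) + r) + h + + 3 - + 4 * (M * M))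
        ≡ (ε - δ) + δ + ((+ 2 * r + h) * (+ 2 * r + h) - + 4 * M * (+ 2 * M + (+ 2 * r + h) + + 3))
      eq = ℤ-Solver.solve-∀
    ∣V∣≤ : ∣ V ∣ ℕ.≤ R
    ∣V∣≤ = ∣i∣≤n V R
      (subst (0ℤ ≤_) (sym (trans (cong (_- V) +R) (upper (+ M) (+ r) (+ H))))
        (((0≤+ 2 ⊗ subst (λ x → 0ℤ ≤ x - + r) (ℤ.pos-* 2 M) (0≤n-m r≤2M)) ⊕ 0≤n-m (ℕ.≤-trans (ℕ.m≤m+n H 3) H+3≤M))
          ⊗ (0≤+ 2 ⊗ 0≤+ r ⊕ 0≤+ H ⊕ 0≤+ M)
        ⊕ 0≤+ 15 ⊗ (0≤+ M ⊗ 0≤+ M) ⊕ 0≤+ 24 ⊗ 0≤+ M))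
      -- This side dictates the constant 12 M (M + 1): `V` plus it is the perfect square (y - 2 M)².
      (subst (0ℤ ≤_) (sym (trans (cong (_+ V) +R) (lower (+ M) y))) (0≤i² (y - + 2 * + M)))
      where
      upper : ∀ M r h →
        + 12 * (M * (1ℤ + M)) - ((+ 2 * r + h) * (+ 2 * r + h) - + 4 * M * (+ 2 * M + (+ 2 * r + h) + + 3))
        ≡ (+ 2 * (+ 2 * M - r) + (M - h)) * (+ 2 * r + h + M) + + 15 * (M * M) + + 24 * M
      upper = ℤ-Solver.solve-∀
      lower : ∀ M y → + 12 * (M * (1ℤ + M)) + (y * y - + 4 * M * (+ 2 * M + y + + 3))
        ≡ (y - + 2 * M) * (y - + 2 * M)
      lower = ℤ-Solver.solve-∀
  ... | inj₂ 2M<r = begin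
    ∣ + L * gap f n M - G (X n) (+ M) ∣
      ≡⟨ cong ∣_∣ (split (+ L * gap f n M) (G (X n) (+ M)) g′) ⟩
    ∣ (+ L * gap f n M - (G (X n) (+ M) + g′)) + g′ ∣
      ≤⟨ ℤ.∣i+j∣≤∣i∣+∣j∣ (+ L * gap f n M - (G (X n) (+ M) + g′)) g′ ⟩
    ∣ + L * gap f n M - (G (X n) (+ M) + g′) ∣ ℕ.+ ∣ g′ ∣
      ≤⟨ ℕ.+-mono-≤ (full-gap M n oddTri≤n) ∣g′∣≤ ⟩
    2 ℕ.* w ℕ.+ 12 ℕ.* (M ℕ.* suc M) ∎
    where
    open ℕ.≤-Reasoning
    n = evenTri M ℕ.+ r
    Z = X n + + 3 - + 4 * ((1ℤ + + M) * (1ℤ + + M))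
    g′ = G (X n) (1ℤ + + M)
    split : ∀ a g g′ → a - g ≡ (a - (g + g′)) + g′
    split = ℤ-Solver.solve-∀
    oddTri≤n : oddTri M ℕ.≤ n
    oddTri≤n = subst (ℕ._≤ n) (sym (oddTri≡ M)) (ℕ.+-monoʳ-≤ (evenTri M) (subst (ℕ._≤ r) (ℕ.+-comm 1 (2 ℕ.* M)) 2M<r))
    Z≡ : Z ≡ + 2 * (+ M * (+ 2 * + M + 1ℤ) + + r) + + H + + 3 - + 4 * ((1ℤ + + M) * (1ℤ + + M))
    Z≡ = cong (λ e → + 2 * (e + + r) + + H + + 3 - + 4 * ((1ℤ + + M) * (1ℤ + + M))) (+evenTri M)
    -- `Z` simplifies to 2 r - 6 M + H - 1, which lies between H + 1 - 2 M and H + 3 + 2 M for 2 M <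
    -- r < 4 M + 3.
    ∣Z∣≤ : ∣ Z ∣ ℕ.≤ 3 ℕ.* M
    ∣Z∣≤ = ∣i∣≤n Z (3 ℕ.* M)
      (subst (0ℤ ≤_) (sym (trans (cong₂ _-_ (ℤ.pos-* 3 M) Z≡) (upper (+ M) (+ r) (+ H))))
        (0≤n-m H+3≤M ⊕ 0≤+ 2 ⊗ subst (λ x → 0ℤ ≤ x + + 3 - + suc r) (ℤ.pos-* 4 M) (0≤n-m r<4M+3)))
      (subst (0ℤ ≤_) (sym (trans (cong₂ _+_ (ℤ.pos-* 3 M) Z≡) (lower (+ M) (+ r) (+ H))))
        (0≤+ M ⊕ 0≤+ H ⊕ 0≤+ 2 ⊗ subst (λ x → 0ℤ ≤ + r - (1ℤ + x)) (ℤ.pos-* 2 M) (0≤n-m 2M<r) ⊕ 0≤+ 1))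
      where
      upper : ∀ M r h →
        + 3 * M - (+ 2 * (M * (+ 2 * M + 1ℤ) + r) + h + + 3 - + 4 * ((1ℤ + M) * (1ℤ + M)))
        ≡ M - (h + + 3) + + 2 * (+ 4 * M + + 3 - (1ℤ + r))
      upper = ℤ-Solver.solve-∀
      lower : ∀ M r h →
        + 3 * M + (+ 2 * (M * (+ 2 * M + 1ℤ) + r) + h + + 3 - + 4 * ((1ℤ + M) * (1ℤ + M)))
        ≡ M + h + + 2 * (r - (1ℤ + + 2 * M)) + 1ℤ
      lower = ℤ-Solver.solve-∀
    ∣g′∣≤ : ∣ g′ ∣ ℕ.≤ 12 ℕ.* (M ℕ.* suc M)
    ∣g′∣≤ = begin
      ∣ + 4 * (1ℤ + + M) * Z ∣          ≡⟨ ℤ.abs-* (+ 4 * (1ℤ + + M)) Z ⟩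
      ∣ + 4 * + suc M ∣ ℕ.* ∣ Z ∣       ≡⟨ cong (ℕ._* ∣ Z ∣) (ℤ.abs-* (+ 4) (+ suc M)) ⟩
      4 ℕ.* suc M ℕ.* ∣ Z ∣             ≤⟨ ℕ.*-monoʳ-≤ (4 ℕ.* suc M) ∣Z∣≤ ⟩
      4 ℕ.* suc M ℕ.* (3 ℕ.* M)         ≡⟨ eq M ⟩
      12 ℕ.* (M ℕ.* suc M)              ∎
      where
      eq : ∀ M → 4 ℕ.* suc M ℕ.* (3 ℕ.* M) ≡ 12 ℕ.* (M ℕ.* suc M)
      eq = ℕ-Solver.solve-∀

  -- G(k₀) against the total error in the worst case: r = 0, where X is least, and k = 1, where the
  -- number of gaps is greatest.
  Threshold : ℕ → ℕ → Set
  Threshold k₀ M = 0ℤ ≤ + 4 * + k₀ * (+ 4 * (+ M * + M) + + 2 * + M + + H + + 3 - + 4 * (+ k₀ * + k₀))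
    - (+ 12 * (+ M * (1ℤ + + M)) + + 2 * + w * + M)

  -- G(k) minus the error is split into four nonnegative parts: G(k) - G(k₀) = 4 (k - k₀) (X + 3 - 4
  -- (k² + k k₀ + k₀²)), whose last factor is nonnegative by k < M, k₀ ≤ 2 and 2 k₀² ≤ M; the share
  -- 8 k₀ r of r in G(k₀); the saving 2 w (k - 1) from having fewer gaps; and the threshold.
  altSum-nonneg : ∀ k₀ k l r → let M = suc l ℕ.+ k in
    k₀ ℕ.≤ k → 1 ℕ.≤ k → k₀ ℕ.≤ 2 → 2 ℕ.* (k₀ ℕ.* k₀) ℕ.≤ M → Threshold k₀ M →
    H ℕ.+ 3 ℕ.≤ M → r ℕ.< 4 ℕ.* M ℕ.+ 3 →
    0ℤ ≤ altSum (gap f (evenTri M ℕ.+ r)) k (suc (suc l))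
  altSum-nonneg k₀ k l r k₀≤k 1≤k k₀≤2 2k₀²≤M threshold H+3≤M r<4M+3 =
    ℤ.*-cancelˡ-≤-pos 0ℤ _ (+ L) (subst (_≤ + L * altSum (gap f n) k (suc (suc l))) (sym (ℤ.*-zeroʳ (+ L)))
      (0≤-near _ (G (X n) (+ k)) B
        (altSum-near n M (2 ℕ.* w ℕ.+ 12 ℕ.* (M ℕ.* suc M)) (ℕ.m≤m+n (evenTri M) r) (last-gap M r H+3≤M r<4M+3) (suc l) k refl)
        (≤-from-difference difference
          (0≤+ 4 ⊗ 0≤n-m k₀≤k ⊗
             (0≤+ 4 ⊗ 0≤+ k ⊗ 0≤n-m k₀≤2 ⊕ 0≤+ 8 ⊗ 0≤+ k ⊗ 0≤+ l ⊕ 0≤+ 4 ⊗ (0≤+ (suc l) ⊗ 0≤+ (suc l))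
               ⊕ 0≤+ 2 ⊗ subst (λ x → 0ℤ ≤ + M - x) +2k₀² (0≤n-m 2k₀²≤M) ⊕ 0≤+ 2 ⊗ 0≤+ r ⊕ 0≤+ H ⊕ 0≤+ 3)
           ⊕ 0≤+ 8 ⊗ 0≤+ k₀ ⊗ 0≤+ r ⊕ 0≤+ 2 ⊗ 0≤+ w ⊗ 0≤n-m 1≤k ⊕ threshold))))
    where
    open ≡-Reasoning
    M = suc l ℕ.+ k
    n = evenTri M ℕ.+ r
    B = suc l ℕ.* (2 ℕ.* w) ℕ.+ (2 ℕ.* w ℕ.+ 12 ℕ.* (M ℕ.* suc M))
    +2k₀² : + (2 ℕ.* (k₀ ℕ.* k₀)) ≡ + 2 * (+ k₀ * + k₀)
    +2k₀² = trans (ℤ.pos-* 2 (k₀ ℕ.* k₀)) (cong (+ 2 *_) (ℤ.pos-* k₀ k₀))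
    +B : + B ≡ (1ℤ + + l) * (+ 2 * + w) + (+ 2 * + w + + 12 * (+ M * (1ℤ + + M)))
    +B = cong₂ _+_ (trans (ℤ.pos-* (suc l) (2 ℕ.* w)) (cong (λ x → + suc l * x) (ℤ.pos-* 2 w)))
      (cong₂ _+_ (ℤ.pos-* 2 w) (trans (ℤ.pos-* 12 (M ℕ.* suc M)) (cong (+ 12 *_) (ℤ.pos-* M (suc M)))))
    eq : ∀ k₀ k l r h w → let M = 1ℤ + l + k in
      + 4 * k * (+ 2 * (M * (+ 2 * M + 1ℤ) + r) + h + + 3 - + 4 * (k * k))
      - ((1ℤ + l) * (+ 2 * w) + (+ 2 * w + + 12 * (M * (1ℤ + M))))
      ≡ + 4 * (k - k₀) * (+ 4 * k * (+ 2 - k₀) + + 8 * k * l + + 4 * ((1ℤ + l) * (1ℤ + l))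
          + + 2 * (M - + 2 * (k₀ * k₀)) + + 2 * r + h + + 3)
        + + 8 * k₀ * r + + 2 * w * (k - 1ℤ)
        + (+ 4 * k₀ * (+ 4 * (M * M) + + 2 * M + h + + 3 - + 4 * (k₀ * k₀))
           - (+ 12 * (M * (1ℤ + M)) + + 2 * w * M))
    eq = ℤ-Solver.solve-∀
    difference : G (X n) (+ k) - + B ≡ _
    difference = begin
      G (X n) (+ k) - + B
        ≡⟨ cong₂ (λ e b → G (+ 2 * (e + + r) + + H) (+ k) - b) (+evenTri M) +B ⟩
      _ ≡⟨ eq (+ k₀) (+ k) (+ l) (+ r) (+ H) (+ w) ⟩
      _ ∎

-- Evaluation and conclusion

altSum-cong : ∀ {d d′} → d ≗ d′ → ∀ k N → altSum d k N ≡ altSum d′ k N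
altSum-cong d≗d′ k zero    = refl
altSum-cong d≗d′ k (suc N) = cong₂ _-_ (d≗d′ k) (altSum-cong d≗d′ (suc k) N)

altSum-* : ∀ a d k N → altSum (λ m → a * d m) k N ≡ a * altSum d k N
altSum-* a d k zero    = sym (ℤ.*-zeroʳ a)
altSum-* a d k (suc N) = trans (cong (λ s → a * d k - s) (altSum-* a d (suc k) N)) (eq a (d k) _)
  where
  eq : ∀ a x y → a * x - a * y ≡ a * (x - y)
  eq = ℤ-Solver.solve-∀

altSum-zero : ∀ d k N → (∀ m → k ℕ.≤ m → d m ≡ 0ℤ) → altSum d k N ≡ 0ℤ
altSum-zero d k zero    d≡0 = refl
altSum-zero d k (suc N) d≡0 =
  cong₂ _-_ (d≡0 k ℕ.≤-refl) (altSum-zero d (suc k) N λ m k<m → d≡0 m (ℕ.<⇒≤ k<m))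

altSum-stable : ∀ d k J N → J ℕ.≤ N → (∀ m → k ℕ.+ J ℕ.≤ m → d m ≡ 0ℤ) → altSum d k N ≡ altSum d k J
altSum-stable d k zero    N       _         d≡0 =
  altSum-zero d k N λ m k≤m → d≡0 m (subst (ℕ._≤ m) (sym (ℕ.+-identityʳ k)) k≤m)
altSum-stable d k (suc J) (suc N) (s≤s J≤N) d≡0 = cong (λ s → d k - s)
  (altSum-stable d (suc k) J N J≤N λ m k+J≤m → d≡0 m (subst (ℕ._≤ m) (sym (ℕ.+-suc k J)) k+J≤m))

shift-* : ∀ a f e n → shift (λ x → a * f x) e n ≡ a * shift f e n
shift-* a f e n with e <ᵇ suc n
... | true  = refl
... | false = sym (ℤ.*-zeroʳ a)

shift-cong : ∀ {f f′} → f ≗ f′ → ∀ e n → shift f e n ≡ shift f′ e n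
shift-cong f≗f′ e n with e <ᵇ suc n
... | true  = f≗f′ (n ∸ e)
... | false = refl

gap-* : ∀ a f n m → gap (λ x → a * f x) n m ≡ a * gap f n m
gap-* a f n m = trans (cong₂ _-_ (shift-* a f (evenTri m) n) (shift-* a f (oddTri m) n)) (eq a (shift f (evenTri m) n) _)
  where
  eq : ∀ a x y → a * x - a * y ≡ a * (x - y)
  eq = ℤ-Solver.solve-∀

gap-zero : ∀ f n m → n ℕ.< evenTri m → gap f n m ≡ 0ℤ
gap-zero f n m n<e = cong₂ _-_ (shift-< f n<e)
  (shift-< f (ℕ.<-≤-trans n<e (ℕ.*-monoˡ-≤ (2 ℕ.* m ℕ.+ 1) (ℕ.n≤1+n m))))

≤-from-steps : ∀ (f : PowerSeries) → (∀ x → f x ≤ f (suc x)) → ∀ d x → f x ≤ f (d ℕ.+ x)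
≤-from-steps f f≤ zero    x = ℤ.≤-refl
≤-from-steps f f≤ (suc d) x = ℤ.≤-trans (≤-from-steps f f≤ d x) (f≤ (d ℕ.+ x))

gap-nonneg : ∀ f → 0ℤ ≤ f 0 → (∀ x → f x ≤ f (suc x)) → ∀ n m → 0ℤ ≤ gap f n m
gap-nonneg f 0≤f0 f≤ n m with ℕ.<-≤-connex n (oddTri m)
... | inj₂ o≤n with ℕ.m≤n⇒∃[o]m+o≡n o≤n
...   | y , refl = ℤ.i≤j⇒0≤j-i (subst₂ _≤_ (sym (shift-+ f (oddTri m) y))
  (sym (trans (cong (shift f (evenTri m)) e+x≡n) (shift-+ f (evenTri m) _)))
  (≤-from-steps f f≤ (2 ℕ.* m ℕ.+ 1) y))
  where
  e+x≡n : oddTri m ℕ.+ y ≡ evenTri m ℕ.+ (2 ℕ.* m ℕ.+ 1 ℕ.+ y)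
  e+x≡n = trans (cong (ℕ._+ y) (oddTri≡ m)) (ℕ.+-assoc (evenTri m) (2 ℕ.* m ℕ.+ 1) y)
gap-nonneg f 0≤f0 f≤ n m | inj₁ n<o =
  subst (0ℤ ≤_) (sym (trans (cong (λ s → shift f (evenTri m) n - s) (shift-< f n<o)) (ℤ.+-identityʳ _))) shift-nonneg
  where
  shift-nonneg : 0ℤ ≤ shift f (evenTri m) n
  shift-nonneg with evenTri m <ᵇ suc n
  ... | true  = subst (λ x → 0ℤ ≤ f x) (ℕ.+-identityʳ (n ∸ evenTri m))
    (ℤ.≤-trans 0≤f0 (≤-from-steps f f≤ (n ∸ evenTri m) 0))
  ... | false = ℤ.≤-refl

-- As 4 M + 3 is the distance from `evenTri M` to `evenTri (suc M)`, this M is the last index whose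
-- gap can be nonzero.
evenTri-floor : ∀ n → ∃₂ λ M r → r ℕ.< 4 ℕ.* M ℕ.+ 3 × n ≡ evenTri M ℕ.+ r
evenTri-floor zero    = 0 , 0 , s≤s z≤n , refl
evenTri-floor (suc n) with evenTri-floor n
... | M , r , r< , refl with ℕ.m≤n⇒m<n∨m≡n r<
...   | inj₁ r+1< = M , suc r , r+1< , sym (ℕ.+-suc (evenTri M) r)
...   | inj₂ r+1≡ = suc M , 0 , subst (0 ℕ.<_) (ℕ.+-comm 3 (4 ℕ.* suc M)) (s≤s z≤n) ,
  (begin
    suc (evenTri M ℕ.+ r)              ≡⟨ ℕ.+-suc (evenTri M) r ⟨
    evenTri M ℕ.+ suc r                ≡⟨ cong (evenTri M ℕ.+_) r+1≡ ⟩
    evenTri M ℕ.+ (4 ℕ.* M ℕ.+ 3)      ≡⟨ evenTri-suc M ⟨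
    evenTri (suc M)                    ≡⟨ ℕ.+-identityʳ (evenTri (suc M)) ⟨
    evenTri (suc M) ℕ.+ 0              ∎)
  where open ≡-Reasoning

m≤evenTri : ∀ m → m ℕ.≤ evenTri m
m≤evenTri m = subst (λ x → m ℕ.≤ m ℕ.* x) (ℕ.+-comm 1 (2 ℕ.* m)) (ℕ.m≤m*n m (suc (2 ℕ.* m)))

n<evenTri-suc : ∀ M {r} → r ℕ.< 4 ℕ.* M ℕ.+ 3 → evenTri M ℕ.+ r ℕ.< evenTri (suc M)
n<evenTri-suc M {r} r< = subst (evenTri M ℕ.+ r ℕ.<_) (sym (evenTri-suc M)) (ℕ.+-monoʳ-< (evenTri M) r<)

altSum-gap-truncate : ∀ f M r k → r ℕ.< 4 ℕ.* M ℕ.+ 3 → k ℕ.≤ M → let n = evenTri M ℕ.+ r in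
  altSum (gap f n) k (suc n) ≡ altSum (gap f n) k (suc (M ∸ k))
altSum-gap-truncate f M r k r< k≤M = altSum-stable (gap f n) k (suc (M ∸ k)) (suc n)
  (s≤s (ℕ.≤-trans (ℕ.m∸n≤m M k) (ℕ.≤-trans (m≤evenTri M) (ℕ.m≤m+n (evenTri M) r))))
  λ m M<m → gap-zero f n m (ℕ.<-≤-trans (n<evenTri-suc M r<) (evenTri-mono
    (subst (ℕ._≤ m) (trans (ℕ.+-suc k (M ∸ k)) (cong suc (ℕ.m+[n∸m]≡n k≤M))) M<m)))
  where
  n = evenTri M ℕ.+ r

-- Deciding the finitely many remaining cases

nth : List ℤ → ℕ → ℤ
-- The default is never reached: the index is a residue mod b c and the table has length b c.
nth []       _       = 0ℤ
nth (x ∷ xs) zero    = x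
nth (x ∷ xs) (suc i) = nth xs i

nth-applyUpTo : ∀ f {i n} → i ℕ.< n → nth (applyUpTo f n) i ≡ f i
nth-applyUpTo f {zero}  {suc n} _         = refl
nth-applyUpTo f {suc i} {suc n} (s≤s i<n) = nth-applyUpTo (f ∘ suc) i<n

allBelow? : ∀ {P : ℕ → Set} → (∀ x → Dec (P x)) → ∀ n → Dec (∀ x → x ℕ.< n → P x)
allBelow? P? n = map′ (λ all x x<n → all x<n) (λ all {x} x<n → all x x<n) (ℕ.allUpTo? P? n)

module _ (b c : ℕ) .{{_ : NonZero b}} .{{_ : NonZero c}} where

  instance
    _ = ℕ.m*n≢0 b c

  remainders : List ℤ
  remainders = applyUpTo (remainder b c) (b ℕ.* c)

  -- scale b c * parts₃ b c x, read off a table of the remainders.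
  tabulated : List ℤ → PowerSeries
  tabulated table x = + mainTerm b c x + nth table (x ℕ.% (b ℕ.* c))

  Nonneg : PowerSeries → ℕ → ℕ → Set
  Nonneg f k M = ∀ r → r ℕ.< 4 ℕ.* M ℕ.+ 3 → 0ℤ ≤ altSum (gap f (evenTri M ℕ.+ r)) k (suc (M ∸ k))

  nonneg? : ∀ f k M → Dec (Nonneg f k M)
  nonneg? f k M = allBelow? (λ r → 0ℤ ℤ.≤? altSum (gap f (evenTri M ℕ.+ r)) k (suc (M ∸ k))) (4 ℕ.* M ℕ.+ 3)

  -- δ and w are the centre and half the width of the range of the remainder; from
  -- M₁ on, G(1) exceeds the error terms.
  record Numerics (K : ℕ) (δ : ℤ) (w M₁ : ℕ) : Set where
    constructor numerics
    field
      2K≡[1+b][1+c]    : 2 ℕ.* K ≡ suc b ℕ.* suc c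
      column≡          : ∀ x → x ℕ.< b → column b c b x ≡ + x + + K
      parts₃-increases : ∀ x → x ℕ.< b ℕ.* c → parts₃ b c x ≤ parts₃ b c (suc x)
      remainder-near   : ∀ x → x ℕ.< b ℕ.* c → ∣ remainder b c x - δ ∣ ℕ.≤ w
      ∣δ∣≤w            : ∣ δ ∣ ℕ.≤ w
      -- 160 = 10 · 16: with this bound G(2) exceeds the error from M = 16 on.
      w≤160            : w ℕ.≤ 160
      5≤H              : 5 ℕ.≤ H b c
      H+3≤16           : H b c ℕ.+ 3 ℕ.≤ 16
      16≤M₁            : 16 ℕ.≤ M₁
      2+w≤2M₁          : 2 ℕ.+ w ℕ.≤ 2 ℕ.* M₁
      -- With k < M, the index `suc k` runs through 1, ..., M.
      small-M          : ∀ M → M ℕ.< 16 → ∀ k → k ℕ.< M → Nonneg (tabulated remainders) (suc k) M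
      k=1              : ∀ M → M ℕ.< M₁ → Nonneg (tabulated remainders) 1 M

  numerics? : ∀ K δ w M₁ → Dec (Numerics K δ w M₁)
  numerics? K δ w M₁ = map′
    (λ (a₁ , a₂ , a₃ , a₄ , a₅ , a₆ , a₇ , a₈ , a₉ , a₁₀ , a₁₁ , a₁₂) →
      numerics a₁ a₂ a₃ a₄ a₅ a₆ a₇ a₈ a₉ a₁₀ a₁₁ a₁₂)
    (λ (numerics a₁ a₂ a₃ a₄ a₅ a₆ a₇ a₈ a₉ a₁₀ a₁₁ a₁₂) →
      a₁ , a₂ , a₃ , a₄ , a₅ , a₆ , a₇ , a₈ , a₉ , a₁₀ , a₁₁ , a₁₂)
    ( 2 ℕ.* K ℕ.≟ suc b ℕ.* suc c
    ×-dec allBelow? (λ x → column b c b x ℤ.≟ + x + + K) b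
    ×-dec allBelow? (λ x → parts₃ b c x ℤ.≤? parts₃ b c (suc x)) (b ℕ.* c)
    ×-dec allBelow? (λ x → ∣ remainder b c x - δ ∣ ℕ.≤? w) (b ℕ.* c)
    ×-dec ∣ δ ∣ ℕ.≤? w
    ×-dec w ℕ.≤? 160
    ×-dec 5 ℕ.≤? H b c
    ×-dec H b c ℕ.+ 3 ℕ.≤? 16
    ×-dec 16 ℕ.≤? M₁
    ×-dec 2 ℕ.+ w ℕ.≤? 2 ℕ.* M₁
    ×-dec small-M? remainders
    ×-dec k=1? remainders)
    where
    -- The table is a parameter so that it is evaluated only once.
    small-M? : ∀ table → Dec (∀ M → M ℕ.< 16 → ∀ k → k ℕ.< M → Nonneg (tabulated table) (suc k) M)
    small-M? table = allBelow? (λ M → allBelow? (λ k → nonneg? (tabulated table) (suc k) M) M) 16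
    k=1? : ∀ table → Dec (∀ M → M ℕ.< M₁ → Nonneg (tabulated table) 1 M)
    k=1? table = allBelow? (nonneg? (tabulated table) 1) M₁

  -- Assembling the cases

  module _ {K δ w M₁} (N : Numerics K δ w M₁) where
    open Numerics N

    private
      f : PowerSeries
      f = parts₃ b c

    f0≡1 : f 0 ≡ 1ℤ
    f0≡1 = trans (geom-< c (parts₂ b) (ℕ.>-nonZero⁻¹ c)) (geom-< b (geom 1 𝟙) (ℕ.>-nonZero⁻¹ b))

    scale>0 : Positive (+ scale b c)
    scale>0 = positive (+<+ (ℕ.>-nonZero⁻¹ (scale b c) {{ℕ.m*n≢0 8 (b ℕ.* c)}}))

    remainder-≡ : ∀ x → remainder b c x ≡ remainder b c (x ℕ.% (b ℕ.* c))
    remainder-≡ = remainder-% b c K 2K≡[1+b][1+c] (column≡ _)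

    scaled : ∀ x → + scale b c * f x ≡ + mainTerm b c x + remainder b c x
    scaled x = eq (+ scale b c * f x) (+ mainTerm b c x)
      where
      eq : ∀ x y → x ≡ y + (x - y)
      eq = ℤ-Solver.solve-∀

    open Estimate f (scale b c) (H b c) {{scale>0}} (remainder b c) δ w
      (λ x → trans (scaled x) (cong (_+ remainder b c x) (+mainTerm b c x)))
      (λ x → subst (λ ε → ∣ ε - δ ∣ ℕ.≤ w) (sym (remainder-≡ x)) (remainder-near _ (ℕ.m%n<n x (b ℕ.* c))))
      ∣δ∣≤w

    tabulated≗ : ∀ x → tabulated remainders x ≡ + scale b c * f x
    tabulated≗ x = begin
      + mainTerm b c x + nth remainders (x ℕ.% (b ℕ.* c))
        ≡⟨ cong (λ ε → + mainTerm b c x + ε) (nth-applyUpTo (remainder b c) (ℕ.m%n<n x (b ℕ.* c))) ⟩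
      + mainTerm b c x + remainder b c (x ℕ.% (b ℕ.* c))
        ≡⟨ cong (λ ε → + mainTerm b c x + ε) (remainder-≡ x) ⟨
      + mainTerm b c x + remainder b c x
        ≡⟨ scaled x ⟨
      + scale b c * f x ∎
      where open ≡-Reasoning

    -- The table gives `f` multiplied by `scale`; the factor passes through gaps and alternating
    -- sums and, being positive, cancels.
    untabulate : ∀ k M → Nonneg (tabulated remainders) k M → Nonneg f k M
    untabulate k M nonneg r r< = ℤ.*-cancelˡ-≤-pos 0ℤ _ (+ scale b c) {{scale>0}}
      (subst₂ _≤_ (sym (ℤ.*-zeroʳ (+ scale b c))) unscale (nonneg r r<))
      where
      n = evenTri M ℕ.+ r
      unscale : altSum (gap (tabulated remainders) n) k (suc (M ∸ k)) ≡ + scale b c * altSum (gap f n) k (suc (M ∸ k))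
      unscale = trans
        (altSum-cong (λ m → trans
          (cong₂ _-_ (shift-cong tabulated≗ (evenTri m) n) (shift-cong tabulated≗ (oddTri m) n))
          (gap-* (+ scale b c) f n m)) k (suc (M ∸ k)))
        (altSum-* (+ scale b c) (gap f n) k (suc (M ∸ k)))

    -- G(1) contributes 16 M² against 12 M², and the surplus 2 M (2 M - 2 - w) + 4 (b + c) is
    -- nonnegative once 2 M ≥ 2 + w.
    threshold₁ : ∀ M → M₁ ℕ.≤ M → Threshold 1 M
    threshold₁ M M₁≤M = subst (0ℤ ≤_) (sym (eq (+ M) (+ w) (+ b + + c)))
      (0≤+ 2 ⊗ 0≤+ M ⊗ subst (λ x → 0ℤ ≤ x - (+ 2 + + w)) (ℤ.pos-* 2 M) (0≤n-m (ℕ.≤-trans 2+w≤2M₁ (ℕ.*-monoʳ-≤ 2 M₁≤M)))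
        ⊕ 0≤+ 4 ⊗ (0≤+ b ⊕ 0≤+ c))
      where
      eq : ∀ M w h → + 4 * 1ℤ * (+ 4 * (M * M) + + 2 * M + (1ℤ + h) + + 3 - + 4 * (1ℤ * 1ℤ))
          - (+ 12 * (M * (1ℤ + M)) + + 2 * w * M)
        ≡ + 2 * M * (+ 2 * M - (+ 2 + w)) + + 4 * h
      eq = ℤ-Solver.solve-∀

    -- G(2) contributes 32 M² against 12 M². The surplus is 2 M (10 M - w) + 4 M + 8 H - 104, where
    -- the part 4 M + 8 H - 104 vanishes at M = 16, H = 5.
    threshold₂ : ∀ M → 16 ℕ.≤ M → Threshold 2 M
    threshold₂ M 16≤M = subst (0ℤ ≤_) (sym (eq (+ M) (+ w) (+ H b c)))
      (0≤+ 2 ⊗ 0≤+ M ⊗ (0≤+ 10 ⊗ 0≤n-m 16≤M ⊕ 0≤n-m w≤160)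
        ⊕ (0≤+ 4 ⊗ 0≤n-m 16≤M ⊕ 0≤+ 8 ⊗ 0≤n-m 5≤H))
      where
      eq : ∀ M w h → + 4 * + 2 * (+ 4 * (M * M) + + 2 * M + h + + 3 - + 4 * (+ 2 * + 2))
          - (+ 12 * (M * (1ℤ + M)) + + 2 * w * M)
        ≡ + 2 * M * (+ 10 * (M - + 16) + (+ 160 - w)) + (+ 4 * (M - + 16) + + 8 * (h - + 5))
      eq = ℤ-Solver.solve-∀

    nonneg-from : ∀ k₀ k M → k₀ ℕ.≤ k → 1 ℕ.≤ k → k ℕ.< M → k₀ ℕ.≤ 2 → 2 ℕ.* (k₀ ℕ.* k₀) ℕ.≤ M →
      16 ℕ.≤ M → Threshold k₀ M → Nonneg f k M
    nonneg-from k₀ k M k₀≤k 1≤k k<M k₀≤2 2k₀²≤M 16≤M threshold r r<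
      -- Writes M as `suc l + k`, after which `M ∸ k` can be rewritten to `suc l`.
      with l , 1+k+l≡M ← ℕ.m≤n⇒∃[o]m+o≡n k<M
      with refl ← trans (cong suc (ℕ.+-comm l k)) 1+k+l≡M
      rewrite ℕ.m+n∸n≡m (suc l) k =
      altSum-nonneg k₀ k l r k₀≤k 1≤k k₀≤2 2k₀²≤M threshold (ℕ.≤-trans H+3≤16 16≤M) r<

    nonneg : ∀ k M → 1 ℕ.≤ k → k ℕ.≤ M → Nonneg f k M
    nonneg k@(suc k′) M 1≤k k≤M with ℕ.<-≤-connex M 16
    ... | inj₁ M<16 = untabulate k M (small-M M M<16 k′ k≤M)
    ... | inj₂ 16≤M with ℕ.m≤n⇒m<n∨m≡n k≤M
    -- Only the gap at k = M remains, and it is nonnegative by monotonicity.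
    ...   | inj₂ refl rewrite ℕ.n∸n≡0 k′ = λ r _ →
      subst (0ℤ ≤_) (sym (ℤ.+-identityʳ _))
        (gap-nonneg f (subst (0ℤ ≤_) (sym f0≡1) (+≤+ z≤n))
          (parts₃-mono b c K 2K≡[1+b][1+c] (column≡ _) (parts₃-increases _)) (evenTri k ℕ.+ r) k)
    nonneg (suc (suc k)) M 1≤k k≤M | inj₂ 16≤M | inj₁ k<M =
      nonneg-from 2 (suc (suc k)) M (s≤s (s≤s z≤n)) 1≤k k<M ℕ.≤-refl (ℕ.≤-trans (ℕ.m≤m+n 8 8) 16≤M) 16≤M (threshold₂ M 16≤M)
    nonneg (suc zero) M 1≤k k≤M | inj₂ 16≤M | inj₁ k<M with ℕ.<-≤-connex M M₁
    ... | inj₁ M<M₁ = untabulate 1 M (k=1 M M<M₁)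
    ... | inj₂ M₁≤M =
      nonneg-from 1 1 M ℕ.≤-refl 1≤k k<M (s≤s z≤n) (ℕ.≤-trans (ℕ.m≤m+n 2 14) 16≤M) 16≤M (threshold₁ M M₁≤M)

    γ-nonneg : ∀ k n → 1 ℕ.≤ k → 0ℤ ≤ γ 1 b c 2 1 k n
    γ-nonneg k n 1≤k = subst (0ℤ ≤_) (sym (γ≡altSum 1 b c k n)) (go (evenTri-floor n))
      where
      go : (∃₂ λ M r → r ℕ.< 4 ℕ.* M ℕ.+ 3 × n ≡ evenTri M ℕ.+ r) → 0ℤ ≤ altSum (gap f n) k (suc n)
      go (M , r , r< , refl) with ℕ.<-≤-connex M k
      ... | inj₂ k≤M = subst (0ℤ ≤_) (sym (altSum-gap-truncate f M r k r< k≤M)) (nonneg k M 1≤k k≤M r r<)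
      -- Here n < T₂ₖ, so every gap in the sum is zero.
      ... | inj₁ M<k = ℤ.≤-reflexive (sym (altSum-zero (gap f n) k (suc n) λ m k≤m →
        gap-zero f n m (ℕ.<-≤-trans (n<evenTri-suc M r<) (evenTri-mono (ℕ.≤-trans M<k k≤m)))))

corollary2p5 : ∀ (k n : ℕ) → 1 ℕ.≤ k →
    ∀ (a b c : ℕ) →
    (a , b , c) ∈ (1 , 3 , 4) ∷ (1 , 3 , 5) ∷ (1 , 4 , 5) ∷ (1 , 5 , 7) ∷ [] →
    0ℤ ≤ γ a b c 2 1 k n
-- In each case K = (1 + b) (1 + c) / 2, and M₁ = w / 2 + 1 is the least value with 2 + w ≤ 2 M₁.
corollary2p5 k n 1≤k _ _ _ (here refl) =
  γ-nonneg 3 4 (from-yes (numerics? 3 4 10 (- + 8) 40 21)) k n 1≤k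
corollary2p5 k n 1≤k _ _ _ (there (here refl)) =
  γ-nonneg 3 5 (from-yes (numerics? 3 5 12 (- + 5) 44 23)) k n 1≤k
corollary2p5 k n 1≤k _ _ _ (there (there (here refl))) =
  γ-nonneg 4 5 (from-yes (numerics? 4 5 15 (- + 8) 88 45)) k n 1≤k
corollary2p5 k n 1≤k _ _ _ (there (there (there (here refl)))) =
  γ-nonneg 5 7 (from-yes (numerics? 5 7 24 (- + 25) 136 69)) k n 1≤k
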